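{- Assume $I_S\neq\emptyset$ and suppose that every optimal solution to the following problem uses at most one item copy from $\tilde I_\kappa$: maximize the profit of a multiset of items from $G\cup\{a_{eff}\}$ of total size at most $c$ that contains, for each $k\in\{0,\dots,\kappa-1\}$, at most one item copy from $\tilde I_k$. Then there is a value $0\le v\le c$ such that $$\mathrm{OPT}^S_v(G\cup\{a_{eff}^c\})+\mathrm{OPT}_{c-v}(\{a_{eff}\})\ \ge\ \left(1-\frac{\varepsilon}{4}\cdot\frac{1}{\log_2(2/\varepsilon)+1}\right)^{\kappa+1}\mathrm{OPT}(I)-T.$$
   Context: UKP instance $I$: items with profits $p(a)\in(0,1]$, sizes $s(a)\in(0,1]$, capacity $c=1$; for a set $I'$ of items and $0\le v\le c$, $\mathrm{OPT}_v(I')=\max\{\sum p(a)x_a:\sum s(a)x_a\le v,\ x_a\in\mathbb{N}\}$, $\mathrm{OPT}(I')=\mathrm{OPT}_c(I')$. Let $\varepsilon=1/2^{\kappa-1}$, $\kappa\in\mathbb{N}$, $\varepsilon\le1/4$. Let $a_{me}$ maximize $p/s$ over $I$, $P_0=p(a_{me})\lfloor c/s(a_{me})\rfloor$, $T=\frac12\varepsilon P_0$, $K=\frac14\cdot\frac1{\kappa+1}\varepsilon T$, $I_L=\{a\in I:p(a)\ge T\}$, $I_S=I\setminus I_L$, $a_{eff}$ an item of $I_S$ maximizing $p/s$. Standing assumption: $I$ contains no item of profit $2P_0$. For $k\in\{0,\dots,\kappa\}$, $L_k=[2^kT,2^{k+1}T)$ and for $\gamma\in\{0,\dots,2^{\kappa+1}(\kappa+1)-1\}$,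 $L_{k,\gamma}=[2^kT+\gamma2^kK,\ 2^kT+(\gamma+1)2^kK)$. $a_{k,\gamma}$ is an item of minimum size among items of $I_L$ with profit in $L_{k,\gamma}$ (if any); $I_L^{red}$ is the set of all existing $a_{k,\gamma}$; $I_k=\{a\in I_L^{red}:p(a)\in L_k\}$. Gluing: for items $a_1,a_2$ with $s(a_1)+s(a_2)\le c$, $a_1\oplus a_2$ is an item of profit $p(a_1)+p(a_2)$ and size $s(a_1)+s(a_2)$ (glued items are treated as ordinary items). $\tilde I_0=I_0$; for $k=0,\dots,\kappa-1$ and each $\gamma$, $\tilde a_{k+1,\gamma}$ is an item of minimum size among the items of $I_{k+1}\cup\{\tilde a\oplus\tilde a':\tilde a,\tilde a'\in\tilde I_k,\ s(\tilde a)+s(\tilde a')\le c\}$ with profit in $L_{k+1,\gamma}$ (if any), and $\tilde I_{k+1}$ is the set of existing $\tilde a_{k+1,\gamma}$. $G=\bigcup_{k=0}^{\kappa}\tilde I_k$. Let $m=\lceil (P_0/4)/p(a_{eff})\rceil$; if $m$ copies of $a_{eff}$ have total size at most $c$, $a_{eff}^c$ is the item of profit $m\,p(a_{eff})$ and size $m\,s(a_{eff})$ (these copies glued together); otherwise $a_{eff}^c$ does not exist and $G\cup\{a_{eff}^c\}$ means $G$. Structured solutions with a lower bound: for $v\le c$, $\mathrm{OPT}^S_v(G\cup\{a_{eff}^c\})$ is the maximum profit of a multiset of items from $G\cup\{a_{eff}^c\}$ of total size at most $v$ that uses at most one item copy from each $\tilde I_k$ ($k=0,\dots,\kappa$), at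 most one copy of $a_{eff}^c$, and at least one item copy from $\tilde I_{\kappa-2}\cup\tilde I_{\kappa-1}\cup\tilde I_\kappa\cup\{a_{eff}^c\}$; it is $0$ if no such multiset exists.
   Formalization: The item profits and sizes are taken to be rational numbers in (0,1] rather than arbitrary real numbers; the value v and the optimal values are accordingly rational. -}

module Defs where

open import Data.Nat using (ℕ; zero; suc; _∸_) renaming (_+_ to _+ℕ_; _*_ to _*ℕ_; _^_ to _^ℕ_; _<_ to _<ℕ_; _≤_ to _≤ℕ_)
open import Data.Integer using (ℤ; +_; +[1+_]; -[1+_])
open import Data.Rational using (ℚ; mkℚ; _+_; _*_; _-_; _/_; _≤_; _<_; _≤?_; 0ℚ; 1ℚ; ½; 1/_; floor; ceiling)
open import Data.List using (List; []; _∷_)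
open import Data.List.Relation.Unary.All using (All)
open import Data.List.Relation.Unary.Any using (Any)
open import Data.List.Membership.Propositional using (_∈_)
open import Data.Maybe using (Maybe; just; nothing)
open import Data.Product using (Σ; _×_; _,_; ∃)
open import Data.Sum using (_⊎_; inj₁; inj₂)
open import Data.Unit using (⊤)
open import Data.Empty using (⊥)
open import Relation.Nullary using (¬_; yes; no)
open import Relation.Binary.PropositionalEquality using (_≡_)

ℕ→ℚ : ℕ → ℚ
ℕ→ℚ n = + n / 1

ℤ→ℚ : ℤ → ℚ
ℤ→ℚ z = z / 1

_^_ : ℚ → ℕ → ℚ
q ^ zero = 1ℚ
q ^ suc n = q * (q ^ n)

¼ : ℚ
¼ = + 1 / 4

-- multiplicative inverse (only ever applied to positive rationals;
-- set to 0 at 0 to make it total)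
inv : ℚ → ℚ
inv (mkℚ (+ zero) d c) = 0ℚ
inv q@(mkℚ +[1+ n ] d c) = 1/ q
inv q@(mkℚ -[1+ n ] d c) = 1/ q

record Item : Set where
  constructor item
  field
    p : ℚ
    s : ℚ

open Item public

_⊕_ : Item → Item → Item
a ⊕ b = item (p a + p b) (s a + s b)

profitL : List Item → ℚ
profitL [] = 0ℚ
profitL (a ∷ as) = p a + profitL as

sizeL : List Item → ℚ
sizeL [] = 0ℚ
sizeL (a ∷ as) = s a + sizeL as

-- multisets of tagged copies: inj₁ x = a copy of an item x of G,
-- inj₂ x = a copy of the extra item (a_eff or a_eff^c)
untag : Item ⊎ Item → Item
untag (inj₁ x) = x
untag (inj₂ x) = x

profitT : List (Item ⊎ Item) → ℚ
profitT [] = 0ℚ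
profitT (e ∷ es) = p (untag e) + profitT es

sizeT : List (Item ⊎ Item) → ℚ
sizeT [] = 0ℚ
sizeT (e ∷ es) = s (untag e) + sizeT es

AtMostOne : {X : Set} → (X → Set) → List X → Set
AtMostOne P [] = ⊤
AtMostOne P (x ∷ xs) = (P x → All (λ y → ¬ P y) xs) × AtMostOne P xs

IsMax : {X : Set} → (List X → Set) → (List X → ℚ) → ℚ → Set
IsMax {X} F val o =
  Σ (List X) (λ xs → F xs × val xs ≡ o) × ((ys : List X) → F ys → val ys ≤ o)

IsOPT : ℚ → (Item → Set) → ℚ → Set
IsOPT v I' o = IsMax (λ xs → All I' xs × sizeL xs ≤ v) profitL o

IsMax0 : {X : Set} → (List X → Set) → (List X → ℚ) → ℚ → Set
IsMax0 {X} F val o = IsMax F val o ⊎ (((ys : List X) → ¬ F ys) × o ≡ 0ℚ)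

MinChoice : (Item → Set) → (ℚ → Set) → Maybe Item → Set
MinChoice C R nothing = (x : Item) → C x → ¬ R (p x)
MinChoice C R (just x) =
  C x × R (p x) × ((y : Item) → C y → R (p y) → s x ≤ s y)

ε : ℕ → ℚ
ε κ = ½ ^ (κ ∸ 1)

-- P₀ = p(a_me) ⌊c / s(a_me)⌋   (c = 1)
P₀ : Item → ℚ
P₀ ame = p ame * ℤ→ℚ (floor (1ℚ * inv (s ame)))

Tᵖ : ℕ → Item → ℚ
Tᵖ κ ame = ½ * ε κ * P₀ ame

Kᵖ : ℕ → Item → ℚ
Kᵖ κ ame = ¼ * (+ 1 / suc κ) * ε κ * Tᵖ κ ame

-- number of profit subintervals: γ ∈ {0,…,2^(κ+1)(κ+1) − 1}
Γ : ℕ → ℕ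
Γ κ = (2 ^ℕ suc κ) *ℕ suc κ

InLk : ℕ → Item → ℕ → ℚ → Set
InLk κ ame k x =
  ℕ→ℚ (2 ^ℕ k) * Tᵖ κ ame ≤ x × x < ℕ→ℚ (2 ^ℕ suc k) * Tᵖ κ ame

InLkγ : ℕ → Item → ℕ → ℕ → ℚ → Set
InLkγ κ ame k γ x =
  ℕ→ℚ (2 ^ℕ k) * Tᵖ κ ame + ℕ→ℚ γ * ℕ→ℚ (2 ^ℕ k) * Kᵖ κ ame ≤ x ×
  x < ℕ→ℚ (2 ^ℕ k) * Tᵖ κ ame + ℕ→ℚ (suc γ) * ℕ→ℚ (2 ^ℕ k) * Kᵖ κ ame

InIL : ℕ → List Item → Item → Item → Set
InIL κ I ame a = a ∈ I × Tᵖ κ ame ≤ p a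

InIS : ℕ → List Item → Item → Item → Set
InIS κ I ame a = a ∈ I × p a < Tᵖ κ ame

-- The reduced and glued item sets.
-- A k γ is the (optional) choice a_{k,γ}; At k γ the choice ã_{k,γ}.

InIk : ℕ → Item → (ℕ → ℕ → Maybe Item) → ℕ → Item → Set
InIk κ ame A k x =
  Σ ℕ (λ γ → γ <ℕ Γ κ × A k γ ≡ just x) × InLk κ ame k (p x)

InĨ : ℕ → Item → (ℕ → ℕ → Maybe Item) → (ℕ → ℕ → Maybe Item) →
      ℕ → Item → Set
InĨ κ ame A At zero x = InIk κ ame A zero x
InĨ κ ame A At (suc k) x = Σ ℕ (λ γ → γ <ℕ Γ κ × At (suc k) γ ≡ just x)

CandĨ : ℕ → Item → (ℕ → ℕ → Maybe Item) → (ℕ → ℕ → Maybe Item) →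
        ℕ → Item → Set
CandĨ κ ame A At k x =
  InIk κ ame A (suc k) x ⊎
  Σ Item (λ a → Σ Item (λ b →
    InĨ κ ame A At k a × InĨ κ ame A At k b × s a + s b ≤ 1ℚ × x ≡ a ⊕ b))

SpecA : ℕ → List Item → Item → (ℕ → ℕ → Maybe Item) → Set
SpecA κ I ame A = (k γ : ℕ) → k ≤ℕ κ → γ <ℕ Γ κ →
  MinChoice (InIL κ I ame) (InLkγ κ ame k γ) (A k γ)

SpecĨ : ℕ → Item → (ℕ → ℕ → Maybe Item) → (ℕ → ℕ → Maybe Item) → Set
SpecĨ κ ame A At = (k γ : ℕ) → k <ℕ κ → γ <ℕ Γ κ →
  MinChoice (CandĨ κ ame A At k) (InLkγ κ ame (suc k) γ) (At (suc k) γ)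

InG : ℕ → Item → (ℕ → ℕ → Maybe Item) → (ℕ → ℕ → Maybe Item) →
      Item → Set
InG κ ame A At x = Σ ℕ (λ k → k ≤ℕ κ × InĨ κ ame A At k x)

mEff : Item → Item → ℤ
mEff ame aeff = ceiling ((P₀ ame * ¼) * inv (p aeff))

aEffC : Item → Item → Maybe Item
aEffC ame aeff with ℤ→ℚ (mEff ame aeff) * s aeff ≤? 1ℚ
... | yes _ = just (item (ℤ→ℚ (mEff ame aeff) * p aeff)
                         (ℤ→ℚ (mEff ame aeff) * s aeff))
... | no _ = nothing

FromĨ : ℕ → Item → (ℕ → ℕ → Maybe Item) → (ℕ → ℕ → Maybe Item) →
        ℕ → Item ⊎ Item → Set
FromĨ κ ame A At k (inj₁ x) = InĨ κ ame A At k x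
FromĨ κ ame A At k (inj₂ x) = ⊥

IsExtra : Item ⊎ Item → Set
IsExtra (inj₁ _) = ⊥
IsExtra (inj₂ _) = ⊤

ElemS : ℕ → Item → Item → (ℕ → ℕ → Maybe Item) → (ℕ → ℕ → Maybe Item) →
        Item ⊎ Item → Set
ElemS κ ame aeff A At (inj₁ x) = InG κ ame A At x
ElemS κ ame aeff A At (inj₂ x) = aEffC ame aeff ≡ just x

StructFeasible : ℕ → Item → Item → (ℕ → ℕ → Maybe Item) →
                 (ℕ → ℕ → Maybe Item) → ℚ → List (Item ⊎ Item) → Set
StructFeasible κ ame aeff A At v xs =
  All (ElemS κ ame aeff A At) xs ×
  sizeT xs ≤ v ×
  ((k : ℕ) → k ≤ℕ κ → AtMostOne (FromĨ κ ame A At k) xs) ×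
  AtMostOne IsExtra xs ×
  Any (λ e → FromĨ κ ame A At (κ ∸ 2) e ⊎ FromĨ κ ame A At (κ ∸ 1) e ⊎
             FromĨ κ ame A At κ e ⊎ IsExtra e) xs

IsOPTS : ℕ → Item → Item → (ℕ → ℕ → Maybe Item) →
         (ℕ → ℕ → Maybe Item) → ℚ → ℚ → Set
IsOPTS κ ame aeff A At v o =
  IsMax0 (StructFeasible κ ame aeff A At v) profitT o

ElemQ : ℕ → Item → Item → (ℕ → ℕ → Maybe Item) → (ℕ → ℕ → Maybe Item) →
        Item ⊎ Item → Set
ElemQ κ ame aeff A At (inj₁ x) = InG κ ame A At x
ElemQ κ ame aeff A At (inj₂ x) = x ≡ aeff

QFeasible : ℕ → Item → Item → (ℕ → ℕ → Maybe Item) →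
            (ℕ → ℕ → Maybe Item) → List (Item ⊎ Item) → Set
QFeasible κ ame aeff A At xs =
  All (ElemQ κ ame aeff A At) xs ×
  sizeT xs ≤ 1ℚ ×
  ((k : ℕ) → k <ℕ κ → AtMostOne (FromĨ κ ame A At k) xs)

QOptimal : ℕ → Item → Item → (ℕ → ℕ → Maybe Item) →
           (ℕ → ℕ → Maybe Item) → List (Item ⊎ Item) → Set
QOptimal κ ame aeff A At xs =
  QFeasible κ ame aeff A At xs ×
  ((ys : List (Item ⊎ Item)) → QFeasible κ ame aeff A At ys →
     profitT ys ≤ profitT xs)

-- approximation factor (1 − ε/4 · 1/(log₂(2/ε)+1))^(κ+1),
-- where log₂(2/ε) = log₂(2^κ) = κ
factor : ℕ → ℚ
factor κ = (1ℚ - ε κ * ¼ * (+ 1 / suc κ)) ^ suc κ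

{-# OPTIONS --safe #-}

-- A solution of size ≤ 1 has profit < 2 P₀, since profit ≤ (p/s)(a_me) · size for
-- every item of I and, by induction, for every glued item. An optimal solution is
-- transformed as follows. Its large items are inserted one after the other into a
-- "binary counter" with one slot per level: an item meeting an occupied slot is glued
-- to its occupant and carried to the next level, and every rounding costs a factor
-- 1 − K/T. A carry out of level κ would produce profit ≥ 2 P₀, so it never happens.
-- The space of the small items is filled with copies of a_eff, losing at most T.
-- If no item of level ≥ κ − 2 remains, the counter is worth at most P₀/2 while the
-- total is at least (13/16) P₀, so there are enough copies of a_eff to form a_eff^c.
module Submission where

open import Defs
open import Data.Nat using (ℕ; zero; suc; _∸_) renaming (_+_ to _+ℕ_; _*_ to _*ℕ_; _^_ to _^ℕ_; _<_ to _<ℕ_; _≤_ to _≤ℕ_; z≤n to z≤nℕ; s≤s to s≤sℕ; s≤s⁻¹ to s≤s⁻¹ℕ)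
import Data.Nat.Properties as ℕ
open import Data.Integer using (ℤ; +[1+_]; -[1+_]; 1ℤ) renaming (+_ to pos)
import Data.Integer as ℤ
import Data.Integer.Properties as ℤ
import Data.Integer.DivMod as ℤ
open import Data.Rational using (ℚ; mkℚ; _+_; _*_; _-_; -_; _/_; _≤_; _<_; 0ℚ; 1ℚ; ½; 1/_; floor; ceiling; toℚᵘ; positive; nonNegative)
open import Data.Rational.Properties
open import Data.Rational.Solver using (module +-*-Solver)
open +-*-Solver using (solve; _:+_; _:*_; _:-_; :-_; _:=_; con)
open import Data.Rational.Unnormalised using (mkℚᵘ; *≤*; *<*; *≡*; _≃_)
import Data.Rational.Unnormalised.Properties as ℚᵘ
open import Data.List using (List; []; _∷_; _++_; length; map; filter; replicate; cartesianProductWith)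
open import Relation.Binary.Bundles using (DecTotalOrder)
open import Data.List.Extrema (DecTotalOrder.totalOrder ≤-decTotalOrder) using (argmax; argmax-all; f[xs]≤f[argmax])
open import Data.List.Membership.Propositional using (_∈_)
open import Data.List.Membership.Propositional.Properties using (∈-++⁺ˡ; ∈-++⁺ʳ; ∈-filter⁺; ∈-map⁺; ∈-cartesianProductWith⁺)
open import Data.List.Relation.Unary.All as All using (All; []; _∷_)
open import Data.List.Relation.Unary.All.Properties using (all-filter) renaming (map⁺ to All-map⁺; replicate⁺ to All-replicate⁺)
open import Data.List.Relation.Unary.Any as Any using (Any; here; there)
open import Data.List.Relation.Unary.Any.Properties using () renaming (map⁺ to Any-map⁺)
open import Data.Maybe using (Maybe; just; nothing)
import Data.Maybe.Properties as Maybe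
open import Data.Product using (Σ; _×_; _,_; proj₁; proj₂)
open import Data.Sum as Sum using (_⊎_; inj₁; inj₂; [_,_]′)
open import Data.Empty using (⊥; ⊥-elim)
open import Data.Unit using (tt)
open import Function using (_∘_; case_of_)
open import Relation.Nullary using (¬_; yes; no)
open import Relation.Nullary.Decidable using (map′; from-yes; from-no; _×-dec_; _⊎-dec_; _→-dec_; ¬?)
open import Relation.Unary using (Decidable)
open import Relation.Binary.Definitions using (DecidableEquality; tri<; tri≈; tri>)
open import Relation.Binary.PropositionalEquality using (_≡_; _≢_; refl; sym; trans; cong; cong₂; subst; subst₂; module ≡-Reasoning)

-- Ordered arithmetic of ℚ

-- How often an item gets rounded depends on which items it meets, so the loss is charged in
-- advance: an item in a slot with n slots above it counts with weight `q ^ n`, where `q` is 1 -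
-- K/T. A carry spends exactly one such factor, so inserting an item never destroys weight already
-- in the counter. The levels are aligned with P₀: since ε/2 is the inverse of 2^κ, level κ starts
-- exactly at P₀. Two items of level κ are therefore worth at least 2 P₀, while the density of a_me,
-- and with it every profit of size at most 1, is strictly below 2 P₀. Both optima in the conclusion
-- are witnesses that must be produced. They exist because item sizes are positive and come from a
-- finite set, which bounds the length of feasible lists. Most inequalities are certified by `0≤⇒≤`:
-- the difference of the two sides is written as a combination of nonnegative terms, and the ring
-- solver checks the identity.

0≤⇒≤ : ∀ {x y d} → 0ℚ ≤ d → d ≡ y - x → x ≤ y
0≤⇒≤ {x} {y} 0≤d eq =
  subst₂ _≤_ (+-identityʳ x) (solve 2 (λ x y → x :+ (y :- x) := y) refl x y)
    (+-monoʳ-≤ x (subst (0ℚ ≤_) eq 0≤d))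

0<⇒< : ∀ {x y d} → 0ℚ < d → d ≡ y - x → x < y
0<⇒< {x} {y} 0<d eq =
  subst₂ _<_ (+-identityʳ x) (solve 2 (λ x y → x :+ (y :- x) := y) refl x y)
    (+-monoʳ-< x (subst (0ℚ <_) eq 0<d))

≤⇒0≤ : ∀ {x y} → x ≤ y → 0ℚ ≤ y - x
≤⇒0≤ {x} {y} x≤y = subst (_≤ y - x) (+-inverseʳ x) (+-monoˡ-≤ (- x) x≤y)

<⇒0< : ∀ {x y} → x < y → 0ℚ < y - x
<⇒0< {x} {y} x<y = subst (_< y - x) (+-inverseʳ x) (+-monoˡ-< (- x) x<y)

0≤+ : ∀ {x y} → 0ℚ ≤ x → 0ℚ ≤ y → 0ℚ ≤ x + y
0≤+ = +-mono-≤

0≤* : ∀ {x y} → 0ℚ ≤ x → 0ℚ ≤ y → 0ℚ ≤ x * y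
0≤* {x} {y} 0≤x 0≤y = subst (_≤ x * y) (*-zeroʳ x) (*-monoˡ-≤-nonNeg x {{nonNegative 0≤x}} 0≤y)

0<* : ∀ {x y} → 0ℚ < x → 0ℚ < y → 0ℚ < x * y
0<* {x} {y} 0<x 0<y = subst (_< x * y) (*-zeroʳ x) (*-monoʳ-<-pos x {{positive 0<x}} 0<y)

*-mono-≤ : ∀ {w x y z} → 0ℚ ≤ w → 0ℚ ≤ y → w ≤ x → y ≤ z → w * y ≤ x * z
*-mono-≤ {w} {x} {y} {z} 0≤w 0≤y w≤x y≤z =
  ≤-trans (*-monoʳ-≤-nonNeg y {{nonNegative 0≤y}} w≤x)
          (*-monoˡ-≤-nonNeg x {{nonNegative (≤-trans 0≤w w≤x)}} y≤z)

*-scale-≤ : ∀ {x y} c → 0ℚ ≤ c → x ≤ y → c * x ≤ c * y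
*-scale-≤ c 0≤c = *-monoˡ-≤-nonNeg c {{nonNegative 0≤c}}

-- Inverses, integers inside ℚ, floor and ceiling

inv-inverseˡ : ∀ x → 0ℚ < x → inv x * x ≡ 1ℚ
inv-inverseˡ (mkℚ (pos zero) d c) 0<x = ⊥-elim (<-irrefl (sym (↥p≡0⇒p≡0 (mkℚ (pos zero) d c) refl)) 0<x)
inv-inverseˡ x@(mkℚ +[1+ n ] d c) 0<x = *-inverseˡ x
inv-inverseˡ x@(mkℚ -[1+ n ] d c) 0<x = *-inverseˡ x

inv-positive : ∀ x → 0ℚ < x → 0ℚ < inv x
inv-positive (mkℚ (pos zero) d c) 0<x = ⊥-elim (<-irrefl (sym (↥p≡0⇒p≡0 (mkℚ (pos zero) d c) refl)) 0<x)
inv-positive x@(mkℚ +[1+ n ] d c) 0<x = positive⁻¹ (1/ x) {{1/pos⇒pos x}}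
inv-positive (mkℚ -[1+ n ] d c) 0<x with drop-*<* 0<x
... | ()

toℚᵘ-ℤ→ℚ : ∀ i → toℚᵘ (ℤ→ℚ i) ≃ mkℚᵘ i 0
toℚᵘ-ℤ→ℚ i = toℚᵘ-fromℚᵘ (mkℚᵘ i 0)

ℤ→ℚ-mono-≤ : ∀ {i j} → i ℤ.≤ j → ℤ→ℚ i ≤ ℤ→ℚ j
ℤ→ℚ-mono-≤ {i} {j} i≤j = toℚᵘ-cancel-≤
  (ℚᵘ.≤-respˡ-≃ (ℚᵘ.≃-sym (toℚᵘ-ℤ→ℚ i)) (ℚᵘ.≤-respʳ-≃ (ℚᵘ.≃-sym (toℚᵘ-ℤ→ℚ j))
    (*≤* (ℤ.*-monoʳ-≤-nonNeg 1ℤ i≤j))))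

ℤ→ℚ-cancel-< : ∀ {i j} → ℤ→ℚ i < ℤ→ℚ j → i ℤ.< j
ℤ→ℚ-cancel-< i<j = ℤ.≰⇒> (λ j≤i → <-irrefl refl (<-≤-trans i<j (ℤ→ℚ-mono-≤ j≤i)))

ℤ→ℚ-homo-+ : ∀ i j → ℤ→ℚ (i ℤ.+ j) ≡ ℤ→ℚ i + ℤ→ℚ j
ℤ→ℚ-homo-+ i j = toℚᵘ-injective (ℚᵘ.≃-trans (toℚᵘ-ℤ→ℚ (i ℤ.+ j)) (ℚᵘ.≃-trans
  (*≡* (cong (ℤ._* 1ℤ) (sym (cong₂ ℤ._+_ (ℤ.*-identityʳ i) (ℤ.*-identityʳ j)))))
  (ℚᵘ.≃-sym (ℚᵘ.≃-trans (toℚᵘ-homo-+ (ℤ→ℚ i) (ℤ→ℚ j))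
    (ℚᵘ.+-cong (toℚᵘ-ℤ→ℚ i) (toℚᵘ-ℤ→ℚ j))))))

ℤ→ℚ-homo-neg : ∀ i → ℤ→ℚ (ℤ.- i) ≡ - ℤ→ℚ i
ℤ→ℚ-homo-neg i = toℚᵘ-injective (ℚᵘ.≃-trans (toℚᵘ-ℤ→ℚ (ℤ.- i))
  (ℚᵘ.≃-sym (ℚᵘ.≃-trans (toℚᵘ-homo‿- (ℤ→ℚ i)) (ℚᵘ.-‿cong (toℚᵘ-ℤ→ℚ i)))))

ℕ→ℚ-suc : ∀ n → ℕ→ℚ (suc n) ≡ 1ℚ + ℕ→ℚ n
ℕ→ℚ-suc n = ℤ→ℚ-homo-+ 1ℤ (pos n)

ℕ→ℚ-homo-+ : ∀ m n → ℕ→ℚ (m +ℕ n) ≡ ℕ→ℚ m + ℕ→ℚ n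
ℕ→ℚ-homo-+ m n = ℤ→ℚ-homo-+ (pos m) (pos n)

ℕ→ℚ-homo-* : ∀ m n → ℕ→ℚ (m *ℕ n) ≡ ℕ→ℚ m * ℕ→ℚ n
ℕ→ℚ-homo-* zero n = sym (*-zeroˡ (ℕ→ℚ n))
ℕ→ℚ-homo-* (suc m) n = begin
  ℕ→ℚ (n +ℕ m *ℕ n)          ≡⟨ ℕ→ℚ-homo-+ n (m *ℕ n) ⟩
  ℕ→ℚ n + ℕ→ℚ (m *ℕ n)       ≡⟨ cong (ℕ→ℚ n +_) (ℕ→ℚ-homo-* m n) ⟩
  ℕ→ℚ n + ℕ→ℚ m * ℕ→ℚ n      ≡⟨ solve 2 (λ m n → n :+ m :* n := (con 1ℚ :+ m) :* n) refl (ℕ→ℚ m) (ℕ→ℚ n) ⟩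
  (1ℚ + ℕ→ℚ m) * ℕ→ℚ n       ≡⟨ cong (_* ℕ→ℚ n) (ℕ→ℚ-suc m) ⟨
  ℕ→ℚ (suc m) * ℕ→ℚ n        ∎
  where open ≡-Reasoning

ℕ→ℚ-mono-≤ : ∀ {m n} → m ≤ℕ n → ℕ→ℚ m ≤ ℕ→ℚ n
ℕ→ℚ-mono-≤ m≤n = ℤ→ℚ-mono-≤ (ℤ.+≤+ m≤n)

ℕ→ℚ-cancel-< : ∀ {m n} → ℕ→ℚ m < ℕ→ℚ n → m <ℕ n
ℕ→ℚ-cancel-< m<n = ℤ.drop‿+<+ (ℤ→ℚ-cancel-< m<n)

ℕ→ℚ-nonNeg : ∀ n → 0ℚ ≤ ℕ→ℚ n
ℕ→ℚ-nonNeg n = ℕ→ℚ-mono-≤ {0} {n} z≤nℕ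

ℕ→ℚ*1/n≡1 : ∀ n → ℕ→ℚ (suc n) * (pos 1 / suc n) ≡ 1ℚ
ℕ→ℚ*1/n≡1 n = toℚᵘ-injective (ℚᵘ.≃-trans
  (toℚᵘ-homo-* (ℕ→ℚ (suc n)) (pos 1 / suc n)) (ℚᵘ.≃-trans
  (ℚᵘ.*-cong (toℚᵘ-ℤ→ℚ (pos (suc n))) (toℚᵘ-fromℚᵘ (mkℚᵘ (pos 1) n)))
  (*≡* (begin
    (pos (suc n) ℤ.* 1ℤ) ℤ.* 1ℤ ≡⟨ trans (ℤ.*-identityʳ _) (ℤ.*-identityʳ _) ⟩
    pos (suc n)                 ≡⟨ cong pos (ℕ.*-identityˡ (suc n)) ⟨
    pos (1 *ℕ suc n)          ≡⟨ ℤ.*-identityˡ _ ⟨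
    1ℤ ℤ.* pos (1 *ℕ suc n)   ∎))))
  where open ≡-Reasoning

floor-lower : ∀ x → ℤ→ℚ (floor x) ≤ x
floor-lower x@(mkℚ n d c) = toℚᵘ-cancel-≤ (ℚᵘ.≤-respˡ-≃ (ℚᵘ.≃-sym (toℚᵘ-ℤ→ℚ (floor x)))
  (*≤* (subst (floor x ℤ.* pos (suc d) ℤ.≤_) (sym (ℤ.*-identityʳ n)) (ℤ.[n/d]*d≤n n (pos (suc d))))))

floor-upper : ∀ x → x < 1ℚ + ℤ→ℚ (floor x)
floor-upper x@(mkℚ n d c) = subst (x <_) (ℤ→ℚ-homo-+ 1ℤ (floor x))
  (toℚᵘ-cancel-< (ℚᵘ.<-respʳ-≃ (ℚᵘ.≃-sym (toℚᵘ-ℤ→ℚ (ℤ.suc (floor x))))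
    (*<* (subst₂ ℤ._<_ (sym (ℤ.*-identityʳ n))
       (cong (λ i → ℤ.suc i ℤ.* pos (suc d)) (sym (ℤ.div-pos-is-/ℕ n (suc d))))
       (ℤ.n<s[n/ℕd]*d n (suc d))))))

floor-ℕ : ∀ {x} → 0ℚ ≤ x → Σ ℕ λ n → floor x ≡ pos n
floor-ℕ {x} 0≤x with floor x | floor-upper x
... | pos n | _ = n , refl
... | -[1+ n ] | x<1+⌊x⌋ = ⊥-elim (ℤ.≤⇒≯ (ℤ.i<j⇒suc[i]≤j (ℤ.-<+ {n} {0}))
        (ℤ→ℚ-cancel-< (≤-<-trans 0≤x (subst (x <_) (sym (ℤ→ℚ-homo-+ 1ℤ -[1+ n ])) x<1+⌊x⌋))))

ceiling-lower : ∀ x → x ≤ ℤ→ℚ (ceiling x)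
ceiling-lower x@record{} = 0≤⇒≤ (≤⇒0≤ (floor-lower (- x)))
  (trans (solve 2 (λ x f → :- x :- f := :- f :- x) refl x (ℤ→ℚ (floor (- x))))
    (cong (_- x) (sym (ℤ→ℚ-homo-neg (floor (- x))))))

ceiling-upper : ∀ x → ℤ→ℚ (ceiling x) < 1ℚ + x
ceiling-upper x@record{} = 0<⇒< (<⇒0< (floor-upper (- x)))
  (trans (solve 2 (λ x f → (con 1ℚ :+ f) :- :- x := (con 1ℚ :+ x) :- :- f) refl x (ℤ→ℚ (floor (- x))))
    (cong (λ f → (1ℚ + x) - f) (sym (ℤ→ℚ-homo-neg (floor (- x))))))

-- Serves both the bound on the length of feasible lists and the number of copies of `aeff` that fit
-- into the space of the small items.
divide : ∀ x y → 0ℚ ≤ x → 0ℚ < y → Σ ℕ λ n → ℕ→ℚ n * y ≤ x × x < (1ℚ + ℕ→ℚ n) * y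
divide x y 0≤x 0<y = n ,
  subst (ℕ→ℚ n * y ≤_) x/y*y≡x (*-monoʳ-≤-nonNeg y {{nonNegative (<⇒≤ 0<y)}}
    (subst (λ i → ℤ→ℚ i ≤ x * inv y) ⌊x/y⌋≡n (floor-lower (x * inv y)))) ,
  subst (_< (1ℚ + ℕ→ℚ n) * y) x/y*y≡x (*-monoˡ-<-pos y {{positive 0<y}}
    (subst (λ i → x * inv y < 1ℚ + ℤ→ℚ i) ⌊x/y⌋≡n (floor-upper (x * inv y))))
  where
  0≤x/y = 0≤* 0≤x (<⇒≤ (inv-positive y 0<y))
  n = proj₁ (floor-ℕ 0≤x/y)
  ⌊x/y⌋≡n = proj₂ (floor-ℕ 0≤x/y)
  x/y*y≡x : x * inv y * y ≡ x
  x/y*y≡x = trans (*-assoc x (inv y) y) (trans (cong (x *_) (inv-inverseˡ y 0<y)) (*-identityʳ x))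

-- Searches downwards from `n` for the first index with `f i ≤ x`. Applied to the levels and to the
-- cells inside one level.
bracket : ∀ (f : ℕ → ℚ) n {x} → f 0 ≤ x → x < f n → Σ ℕ λ i → i <ℕ n × f i ≤ x × x < f (suc i)
bracket f zero f0≤x x<fn = ⊥-elim (<-irrefl refl (≤-<-trans f0≤x x<fn))
bracket f (suc n) {x} f0≤x x<fn with x <? f n
... | yes x<f = let i , i<n , bounds = bracket f n f0≤x x<f in i , ℕ.m<n⇒m<1+n i<n , bounds
... | no x≮f  = n , ℕ.n<1+n n , ≮⇒≥ x≮f , x<fn

-- Powers

^-nonNeg : ∀ {q} n → 0ℚ ≤ q → 0ℚ ≤ q ^ n
^-nonNeg zero 0≤q = <⇒≤ (positive⁻¹ 1ℚ)
^-nonNeg (suc n) 0≤q = 0≤* 0≤q (^-nonNeg n 0≤q)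

^-antimono-suc : ∀ {q} n → 0ℚ ≤ q → q ≤ 1ℚ → q ^ suc n ≤ q ^ n
^-antimono-suc {q} n 0≤q q≤1 =
  subst (q * q ^ n ≤_) (*-identityˡ _) (*-monoʳ-≤-nonNeg (q ^ n) {{nonNegative (^-nonNeg n 0≤q)}} q≤1)

^-antimono : ∀ {q m n} → 0ℚ ≤ q → q ≤ 1ℚ → m ≤ℕ n → q ^ n ≤ q ^ m
^-antimono {n = zero} 0≤q q≤1 z≤nℕ = ≤-refl
^-antimono {n = suc n} 0≤q q≤1 z≤nℕ = ≤-trans (^-antimono-suc n 0≤q q≤1) (^-antimono {n = n} 0≤q q≤1 z≤nℕ)
^-antimono {q} 0≤q q≤1 (s≤sℕ m≤n) = *-scale-≤ q 0≤q (^-antimono 0≤q q≤1 m≤n)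

bernoulli : ∀ {δ} n → 0ℚ ≤ δ → δ ≤ 1ℚ → 1ℚ - ℕ→ℚ n * δ ≤ (1ℚ - δ) ^ n
bernoulli {δ} zero 0≤δ δ≤1 = ≤-reflexive (solve 1 (λ δ → con 1ℚ :- con 0ℚ :* δ := con 1ℚ) refl δ)
bernoulli {δ} (suc n) 0≤δ δ≤1 = ≤-trans
  (0≤⇒≤ (0≤* (0≤* (ℕ→ℚ-nonNeg n) 0≤δ) 0≤δ)
    (trans (solve 2 (λ n δ → n :* δ :* δ := (con 1ℚ :- δ) :* (con 1ℚ :- n :* δ) :- (con 1ℚ :- (con 1ℚ :+ n) :* δ)) refl (ℕ→ℚ n) δ)
      (cong (λ m → (1ℚ - δ) * (1ℚ - ℕ→ℚ n * δ) - (1ℚ - m * δ)) (sym (ℕ→ℚ-suc n)))))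
  (*-scale-≤ (1ℚ - δ) (≤⇒0≤ δ≤1) (bernoulli n 0≤δ δ≤1))

2^n*½^n≡1 : ∀ n → ℕ→ℚ (2 ^ℕ n) * ½ ^ n ≡ 1ℚ
2^n*½^n≡1 zero = refl
2^n*½^n≡1 (suc n) = begin
  ℕ→ℚ (2 *ℕ 2 ^ℕ n) * (½ * ½ ^ n)        ≡⟨ cong (_* (½ * ½ ^ n)) (ℕ→ℚ-homo-* 2 (2 ^ℕ n)) ⟩
  ℕ→ℚ 2 * ℕ→ℚ (2 ^ℕ n) * (½ * ½ ^ n)     ≡⟨ solve 2 (λ a b → con (ℕ→ℚ 2) :* a :* (con ½ :* b) := a :* b) refl (ℕ→ℚ (2 ^ℕ n)) (½ ^ n) ⟩
  ℕ→ℚ (2 ^ℕ n) * ½ ^ n                    ≡⟨ 2^n*½^n≡1 n ⟩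
  1ℚ                                      ∎
  where open ≡-Reasoning

½^n-positive : ∀ n → 0ℚ < ½ ^ n
½^n-positive zero = positive⁻¹ 1ℚ
½^n-positive (suc n) = 0<* (positive⁻¹ ½) (½^n-positive n)

-- Existence of optimal solutions

-- Only completeness is asked of the list, which may contain elements outside `P`. Finiteness thus
-- passes to subsets without a decision procedure.
Finite : {X : Set} → (X → Set) → Set
Finite {X} P = Σ (List X) λ xs → ∀ x → P x → x ∈ xs

finite-⊆ : {X : Set} {P Q : X → Set} → (∀ x → P x → Q x) → Finite Q → Finite P
finite-⊆ P⊆Q (xs , complete) = xs , λ x → complete x ∘ P⊆Q x

finite-⊎ : {X : Set} {P Q : X → Set} → Finite P → Finite Q → Finite (λ x → P x ⊎ Q x)
finite-⊎ (xs , complete-xs) (ys , complete-ys) = xs ++ ys ,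
  λ x → [ ∈-++⁺ˡ ∘ complete-xs x , ∈-++⁺ʳ xs ∘ complete-ys x ]′

finite-just : {X : Set} (m : Maybe X) → Finite (λ x → m ≡ just x)
finite-just (just y) = y ∷ [] , λ { x refl → here refl }
finite-just nothing = [] , λ { x () }

finite-∃< : {X : Set} {P : ℕ → X → Set} → (∀ i → Finite (P i)) →
            ∀ n → Finite (λ x → Σ ℕ λ i → i <ℕ n × P i x)
finite-∃< fin zero = [] , λ { x (i , () , _) }
finite-∃< {P = P} fin (suc n) = finite-⊆ split (finite-⊎ (finite-∃< fin n) (fin n))
  where
  split : ∀ x → (Σ ℕ λ i → i <ℕ suc n × P i x) → (Σ ℕ λ i → i <ℕ n × P i x) ⊎ P n x
  split x (i , s≤sℕ i≤n , px) with ℕ.m≤n⇒m<n∨m≡n i≤n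
  ... | inj₁ i<n  = inj₁ (i , i<n , px)
  ... | inj₂ refl = inj₂ px

finite-map : {X Y : Set} {P : X → Set} (f : X → Y) → Finite P → Finite (λ y → Σ X λ x → P x × y ≡ f x)
finite-map f (xs , complete) = map f xs , λ { y (x , px , refl) → ∈-map⁺ f (complete x px) }

listsOver : {X : Set} → List X → ℕ → List (List X)
listsOver U zero = [] ∷ []
listsOver U (suc n) = [] ∷ cartesianProductWith _∷_ U (listsOver U n)

∈-listsOver : {X : Set} {U : List X} {n : ℕ} {xs : List X} →
              All (_∈ U) xs → length xs ≤ℕ n → xs ∈ listsOver U n
∈-listsOver {n = zero} [] _ = here refl
∈-listsOver {n = suc n} [] _ = here refl
∈-listsOver {n = suc n} (x∈U ∷ xs⊆U) (s≤sℕ len) =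
  there (∈-cartesianProductWith⁺ _∷_ x∈U (∈-listsOver xs⊆U len))

-- The feasible `xs₀` is the default of `argmax`, which keeps the maximiser feasible.
maximum : {X : Set} {F : List X → Set} (val : List X → ℚ) → Decidable F →
          (U : List X) (n : ℕ) → (∀ {xs} → F xs → All (_∈ U) xs × length xs ≤ℕ n) →
          ∀ {xs₀} → F xs₀ → Σ ℚ λ o → IsMax F val o × val xs₀ ≤ o
maximum {F = F} val F? U n bounded {xs₀} f₀ =
  val best , ((best , argmax-all val f₀ (all-filter F? candidates) , refl) , upper) , upper xs₀ f₀
  where
  candidates = listsOver U n
  best = argmax val xs₀ (filter F? candidates)
  upper : ∀ ys → F ys → val ys ≤ val best
  upper ys fys = All.lookup (f[xs]≤f[argmax] {f = val} xs₀ (filter F? candidates))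
    (∈-filter⁺ F? (∈-listsOver (proj₁ (bounded fys)) (proj₂ (bounded fys))) fys)

positive-lower-bound : {X : Set} (w : X → ℚ) (U : List X) → All (λ x → 0ℚ < w x) U →
                       Σ ℚ λ l → 0ℚ < l × All (λ x → l ≤ w x) U
positive-lower-bound w [] [] = 1ℚ , positive⁻¹ 1ℚ , []
positive-lower-bound w (x ∷ U) (0<wx ∷ 0<w) with positive-lower-bound w U 0<w
... | l , 0<l , l≤ with ≤-total l (w x)
...   | inj₁ l≤wx = l , 0<l , l≤wx ∷ l≤
...   | inj₂ wx≤l = w x , 0<wx , ≤-refl ∷ All.map (≤-trans wx≤l) l≤

-- Abstract in the size function so as to cover plain items (`sizeL`) and tagged copies (`sizeT`) at
-- once.
module Knapsack {X : Set} (w : X → ℚ) (size val : List X → ℚ)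
  (size-[] : size [] ≡ 0ℚ) (size-∷ : ∀ x xs → size (x ∷ xs) ≡ w x + size xs) where

  length-bound : ∀ {l xs} → All (λ x → l ≤ w x) xs → ℕ→ℚ (length xs) * l ≤ size xs
  length-bound {l} [] = ≤-reflexive (trans (*-zeroˡ l) (sym size-[]))
  length-bound {l} {x ∷ xs} (l≤wx ∷ l≤) = begin
    ℕ→ℚ (suc (length xs)) * l      ≡⟨ cong (_* l) (ℕ→ℚ-suc (length xs)) ⟩
    (1ℚ + ℕ→ℚ (length xs)) * l     ≡⟨ solve 2 (λ n l → (con 1ℚ :+ n) :* l := l :+ n :* l) refl (ℕ→ℚ (length xs)) l ⟩
    l + ℕ→ℚ (length xs) * l        ≤⟨ +-mono-≤ l≤wx (length-bound l≤) ⟩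
    w x + size xs                  ≡⟨ size-∷ x xs ⟨
    size (x ∷ xs)                  ∎
    where open ≤-Reasoning

  -- If all elements have size at least l > 0, a list of total size at most 1 has at most 1/l
  -- entries, so only finitely many lists compete.
  optimum : {E : X → Set} {F : List X → Set} → Finite E → (∀ x → E x → 0ℚ < w x) → Decidable E → Decidable F →
            (∀ {xs} → F xs → All E xs × size xs ≤ 1ℚ) →
            ∀ {xs₀} → F xs₀ → Σ ℚ λ o → IsMax F val o × val xs₀ ≤ o
  optimum {E} {F} (U , complete) E-pos E? F? F⇒ =
    maximum val F? U n (λ {xs} f → All.map (λ {x} → complete x) (proj₁ (F⇒ f)) , bound xs f)
    where
    -- `U` may contain elements outside `E`, whose size need not be positive; they are filtered out
    -- before the lower bound is taken.
    lb = positive-lower-bound w (filter E? U) (All.map (λ {x} → E-pos x) (all-filter E? U))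
    l = proj₁ lb
    0<l = proj₁ (proj₂ lb)
    quot = divide 1ℚ l (<⇒≤ (positive⁻¹ 1ℚ)) 0<l
    n = proj₁ quot
    bound : ∀ xs → F xs → length xs ≤ℕ n
    bound xs f = s≤s⁻¹ℕ (ℕ→ℚ-cancel-< (*-cancelʳ-<-nonNeg l {{nonNegative (<⇒≤ 0<l)}}
      (≤-<-trans (≤-trans (length-bound (All.map
          (λ {x} e → All.lookup (proj₂ (proj₂ lb)) (∈-filter⁺ E? (complete x e) e)) (proj₁ (F⇒ f))))
          (proj₂ (F⇒ f)))
        (subst (λ m → 1ℚ < m * l) (sym (ℕ→ℚ-suc n)) (proj₂ (proj₂ quot))))))

-- Gluing as binary carrying

-- n slots for the levels k, …, k + n − 1, each holding at most one item of its level.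
data Counter (P : ℕ → Item → Set) : ℕ → ℕ → List Item → Set where
  []   : ∀ {k} → Counter P k 0 []
  skip : ∀ {k n xs} → Counter P (suc k) n xs → Counter P k (suc n) xs
  put  : ∀ {k n x xs} → P k x → Counter P (suc k) n xs → Counter P k (suc n) (x ∷ xs)

-- Every later gluing step costs a factor q, so an item is discounted by
-- one factor q for each level that is still above it.
weight : ∀ {P k n xs} → ℚ → Counter P k n xs → ℚ
weight q [] = 0ℚ
weight q (skip c) = weight q c
weight q (put {n = n} {x = x} _ c) = q ^ n * p x + weight q c

counter-empty : ∀ {P} k n → Counter P k n []
counter-empty k zero = []
counter-empty k (suc n) = skip (counter-empty (suc k) n)

weight-empty : ∀ {P} q k n → weight q (counter-empty {P} k n) ≡ 0ℚ
weight-empty q k zero = refl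
weight-empty q k (suc n) = weight-empty q (suc k) n

counter-levels : ∀ {P k n xs} → Counter P k n xs → All (λ x → Σ ℕ λ j → k ≤ℕ j × P j x) xs
counter-levels [] = []
counter-levels (skip c) = All.map (λ { (j , k<j , pj) → j , ℕ.<⇒≤ k<j , pj }) (counter-levels c)
counter-levels {k = k} (put px c) = (k , ℕ.≤-refl , px) ∷
  All.map (λ { (j , k<j , pj) → j , ℕ.<⇒≤ k<j , pj }) (counter-levels c)

-- Levels strictly increase along the counter and no item belongs to two levels, so two entries
-- never share one.
counter-atMostOne : ∀ {P k n xs} → (∀ {i j x} → P i x → P j x → i ≡ j) →
                    Counter P k n xs → ∀ i → AtMostOne (P i) xs
counter-atMostOne disjoint [] i = tt
counter-atMostOne disjoint (skip c) i = counter-atMostOne disjoint c i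
counter-atMostOne disjoint (put px c) i =
  (λ pix → All.map (λ { (j , k<j , pj) piy →
      ℕ.<-irrefl (trans (disjoint px pix) (disjoint piy pj)) k<j }) (counter-levels c)) ,
  counter-atMostOne disjoint c i

atMostOne-map : {X Y : Set} {R : X → Set} {S : Y → Set} (f : X → Y) → (∀ x → S (f x) → R x) →
                ∀ xs → AtMostOne R xs → AtMostOne S (map f xs)
atMostOne-map f S⇒R [] _ = tt
atMostOne-map f S⇒R (x ∷ xs) (once , rest) =
  (λ sx → All-map⁺ (All.map (λ {y} ¬ry → ¬ry ∘ S⇒R y) (once (S⇒R x sx)))) , atMostOne-map f S⇒R xs rest

atMostOne-none : {X : Set} {R : X → Set} → ∀ {xs} → All (¬_ ∘ R) xs → AtMostOne R xs
atMostOne-none [] = tt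
atMostOne-none (¬rx ∷ ¬rxs) = (λ rx → ⊥-elim (¬rx rx)) , atMostOne-none ¬rxs

sizeL-nonNeg : ∀ {xs} → All (λ x → 0ℚ ≤ s x) xs → 0ℚ ≤ sizeL xs
sizeL-nonNeg [] = ≤-refl
sizeL-nonNeg (0≤x ∷ 0≤xs) = 0≤+ 0≤x (sizeL-nonNeg 0≤xs)

module Gluing (P : ℕ → Item → Set) (κ : ℕ) (q : ℚ) (0≤q : 0ℚ ≤ q)
  (s-nonNeg : ∀ {k x} → P k x → 0ℚ ≤ s x)
  (glue : ∀ {k x y} → k <ℕ κ → P k x → P k y → s x + s y ≤ 1ℚ →
          Σ Item λ z → P (suc k) z × s z ≤ s x + s y × q * (p x + p y) ≤ p z)
  (overflow : ∀ {x y} → P κ x → P κ y → s x + s y ≤ 1ℚ → ⊥) where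

  counter-size : ∀ {k n xs} → Counter P k n xs → 0ℚ ≤ sizeL xs
  counter-size c = sizeL-nonNeg (All.map (s-nonNeg ∘ proj₂ ∘ proj₂) (counter-levels c))

  -- `m` counts the slots above the level at which `x` enters, so `q ^ m * p x` is the weight of `x`
  -- in that slot. Carries replace several items by one, so only total size and weight of the new
  -- counter are tracked.
  Inserted : (k n m : ℕ) (x : Item) (xs : List Item) → Counter P k n xs → Set
  Inserted k n m x xs c = Σ (List Item) λ ys → Σ (Counter P k n ys) λ d →
    sizeL ys ≤ s x + sizeL xs × q ^ m * p x + weight q c ≤ weight q d

  -- Gluing `x` to the occupant `y` leaves profit at least q (p x + p y), but one slot higher, where
  -- the discount has one factor `q` fewer. The two effects cancel, so a carry costs no weight.
  insert : ∀ {k xs x} n → k +ℕ n ≡ κ → P k x → (c : Counter P k (suc n) xs) →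
           s x + sizeL xs ≤ 1ℚ → Inserted k (suc n) n x xs c
  insert {xs = xs} {x} n k+n≡κ px (skip c) fits = x ∷ xs , put px c , ≤-refl , ≤-refl
  -- No slot lies above, so the level is κ and the carry would leave the counter.
  insert {x = x} zero k+0≡κ px (put {x = y} py []) fits =
    ⊥-elim (overflow (at-κ px) (at-κ py) (subst (λ a → s x + a ≤ 1ℚ) (+-identityʳ (s y)) fits))
    where
    at-κ : ∀ {x} → P _ x → P κ x
    at-κ {x} = subst (λ j → P j x) (trans (sym (ℕ.+-identityʳ _)) k+0≡κ)
  insert {k} {x = x} (suc n) k+n≡κ px (put {x = y} {xs = xs} py c) fits =
    ys , skip d , ≤-trans ys≤ (≤-trans z+xs≤ (≤-reflexive (+-assoc (s x) (s y) (sizeL xs)))) ,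
    ≤-trans (0≤⇒≤ (0≤* (^-nonNeg n 0≤q) (≤⇒0≤ q*≤z))
      (solve 6 (λ q Q x y z w → Q :* (z :- q :* (x :+ y)) :=
          (Q :* z :+ w) :- (q :* Q :* x :+ (q :* Q :* y :+ w))) refl q (q ^ n) (p x) (p y) (p z) (weight q c)))
      w≤
    where
    x+y+xs≤1 : s x + s y + sizeL xs ≤ 1ℚ
    x+y+xs≤1 = subst (_≤ 1ℚ) (sym (+-assoc (s x) (s y) (sizeL xs))) fits
    x+y≤1 : s x + s y ≤ 1ℚ
    x+y≤1 = ≤-trans (subst (_≤ s x + s y + sizeL xs) (+-identityʳ (s x + s y))
      (+-monoʳ-≤ (s x + s y) (counter-size c))) x+y+xs≤1
    k<κ : k <ℕ κ
    k<κ = subst (k <ℕ_) (trans (sym (ℕ.+-suc k n)) k+n≡κ) (ℕ.m≤m+n (suc k) n)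
    glued = glue k<κ px py x+y≤1
    z = proj₁ glued
    q*≤z = proj₂ (proj₂ (proj₂ glued))
    z+xs≤ : s z + sizeL xs ≤ s x + s y + sizeL xs
    z+xs≤ = +-monoˡ-≤ (sizeL xs) (proj₁ (proj₂ (proj₂ glued)))
    inserted = insert n (trans (sym (ℕ.+-suc k n)) k+n≡κ) (proj₁ (proj₂ glued)) c (≤-trans z+xs≤ x+y+xs≤1)
    ys = proj₁ inserted
    d = proj₁ (proj₂ inserted)
    ys≤ = proj₁ (proj₂ (proj₂ inserted))
    w≤ = proj₂ (proj₂ (proj₂ inserted))

  -- The i slots below the level of `x` are left alone. Nonnegativity of sizes lets their occupants
  -- be dropped from the fit condition.
  insertAbove : ∀ {k xs x} i {j} n → i +ℕ k ≡ j → j +ℕ n ≡ κ → P j x → (c : Counter P k (suc (i +ℕ n)) xs) →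
                s x + sizeL xs ≤ 1ℚ → Inserted k (suc (i +ℕ n)) n x xs c
  insertAbove zero n refl j+n≡κ px c fits = insert n j+n≡κ px c fits
  insertAbove {k} (suc i) n i+k≡j j+n≡κ px (skip c) fits =
    let ys , d , size≤ , w≤ = insertAbove i n (trans (ℕ.+-suc i k) i+k≡j) j+n≡κ px c fits
    in ys , skip d , size≤ , w≤
  insertAbove {k} {x = x} (suc i) n i+k≡j j+n≡κ px (put {x = y} {xs = xs} py c) fits =
    let ys , d , size≤ , w≤ = insertAbove i n (trans (ℕ.+-suc i k) i+k≡j) j+n≡κ px c
          (≤-trans (+-monoʳ-≤ (s x) (subst (_≤ s y + sizeL xs) (+-identityˡ (sizeL xs))
            (+-monoˡ-≤ (sizeL xs) (s-nonNeg py)))) fits)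
    in y ∷ ys , put py d ,
       ≤-trans (+-monoʳ-≤ (s y) size≤)
         (≤-reflexive (solve 3 (λ x y z → y :+ (x :+ z) := x :+ (y :+ z)) refl (s x) (s y) (sizeL xs))) ,
       ≤-trans (≤-reflexive (solve 3 (λ x y z → x :+ (y :+ z) := y :+ (x :+ z)) refl
           (q ^ n * p x) (q ^ suc (i +ℕ n) * p y) (weight q c)))
         (+-monoʳ-≤ (q ^ suc (i +ℕ n) * p y) w≤)

  insertLevel : ∀ {xs x j} n → j +ℕ n ≡ κ → P j x → (c : Counter P 0 (suc κ) xs) →
                s x + sizeL xs ≤ 1ℚ → Inserted 0 (suc κ) n x xs c
  insertLevel {xs} {x} {j} n j+n≡κ px = subst
    (λ m → (c : Counter P 0 (suc m) xs) → s x + sizeL xs ≤ 1ℚ → Inserted 0 (suc m) n x xs c)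
    j+n≡κ (insertAbove j n (ℕ.+-identityʳ j) j+n≡κ px)

weight≤profit : ∀ {P q k n xs} → (∀ {k x} → P k x → 0ℚ ≤ p x) → 0ℚ ≤ q → q ≤ 1ℚ →
                (c : Counter P k n xs) → weight q c ≤ profitL xs
weight≤profit p-nonNeg 0≤q q≤1 [] = ≤-refl
weight≤profit p-nonNeg 0≤q q≤1 (skip c) = weight≤profit p-nonNeg 0≤q q≤1 c
weight≤profit {q = q} p-nonNeg 0≤q q≤1 (put {n = n} {x = x} px c) =
  +-mono-≤ (subst (q ^ n * p x ≤_) (*-identityˡ (p x))
      (*-mono-≤ (^-nonNeg n 0≤q) (p-nonNeg px) (^-antimono {n = n} 0≤q q≤1 z≤nℕ) ≤-refl))
    (weight≤profit p-nonNeg 0≤q q≤1 c)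

-- The profit bounds of the slots k, ..., t - 1 form a geometric series: f (k+1) + ... + f t = f
-- (t+1) - f (k+1) when `f` doubles. Keeping `f (suc k)` on the left makes the induction telescope.
-- With `level` for `f` and t = κ - 2 the right side is P₀/2.
top-or-cheap : ∀ {P} (f : ℕ → ℚ) → (∀ j → f (suc j) ≡ f j + f j) → (∀ j → 0ℚ ≤ f j) →
               (∀ {k x} → P k x → p x ≤ f (suc k)) →
               ∀ {k t xs} m → m +ℕ k ≡ t → Counter P k (m +ℕ 3) xs →
               Any (λ x → P t x ⊎ P (suc t) x ⊎ P (suc (suc t)) x) xs ⊎ profitL xs + f (suc k) ≤ f (suc t)
top-or-cheap f double f-nonNeg p≤f zero refl (put px c) = inj₁ (here (inj₁ px))
top-or-cheap f double f-nonNeg p≤f zero refl (skip (put px c)) = inj₁ (here (inj₂ (inj₁ px)))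
top-or-cheap f double f-nonNeg p≤f zero refl (skip (skip (put px c))) = inj₁ (here (inj₂ (inj₂ px)))
top-or-cheap f double f-nonNeg p≤f zero refl (skip (skip (skip []))) = inj₂ (≤-reflexive (+-identityˡ _))
top-or-cheap f double f-nonNeg p≤f {k} {xs = xs} (suc m) m+k≡t (skip c) =
  Sum.map₂ (≤-trans (+-monoʳ-≤ (profitL xs) (subst (f (suc k) ≤_) (sym (double (suc k)))
      (subst (_≤ f (suc k) + f (suc k)) (+-identityʳ (f (suc k))) (+-monoʳ-≤ (f (suc k)) (f-nonNeg (suc k)))))))
    (top-or-cheap f double f-nonNeg p≤f m (trans (ℕ.+-suc m k) m+k≡t) c)
top-or-cheap f double f-nonNeg p≤f {k} (suc m) m+k≡t (put {x = x} {xs = xs} px c) =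
  Sum.map there (≤-trans (≤-trans (+-monoˡ-≤ (f (suc k)) (+-monoˡ-≤ (profitL xs) (p≤f px)))
      (≤-reflexive (trans (solve 2 (λ a b → a :+ b :+ a := b :+ (a :+ a)) refl (f (suc k)) (profitL xs))
        (cong (profitL xs +_) (sym (double (suc k))))))))
    (top-or-cheap f double f-nonNeg p≤f m (trans (ℕ.+-suc m k) m+k≡t) c)

-- The parameters ε, K, T, P₀

profit-replicate : ∀ n a → profitL (replicate n a) ≡ ℕ→ℚ n * p a
profit-replicate zero a = sym (*-zeroˡ (p a))
profit-replicate (suc n) a = begin
  p a + profitL (replicate n a) ≡⟨ cong (p a +_) (profit-replicate n a) ⟩
  p a + ℕ→ℚ n * p a             ≡⟨ solve 2 (λ n a → a :+ n :* a := (con 1ℚ :+ n) :* a) refl (ℕ→ℚ n) (p a) ⟩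
  (1ℚ + ℕ→ℚ n) * p a            ≡⟨ cong (_* p a) (ℕ→ℚ-suc n) ⟨
  ℕ→ℚ (suc n) * p a             ∎
  where open ≡-Reasoning

size-replicate : ∀ n a → sizeL (replicate n a) ≡ ℕ→ℚ n * s a
size-replicate zero a = sym (*-zeroˡ (s a))
size-replicate (suc n) a = begin
  s a + sizeL (replicate n a) ≡⟨ cong (s a +_) (size-replicate n a) ⟩
  s a + ℕ→ℚ n * s a           ≡⟨ solve 2 (λ n a → a :+ n :* a := (con 1ℚ :+ n) :* a) refl (ℕ→ℚ n) (s a) ⟩
  (1ℚ + ℕ→ℚ n) * s a          ≡⟨ cong (_* s a) (ℕ→ℚ-suc n) ⟨
  ℕ→ℚ (suc n) * s a           ∎
  where open ≡-Reasoning

density : Item → ℚ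
density a = p a * inv (s a)

density-* : ∀ a → 0ℚ < s a → density a * s a ≡ p a
density-* a 0<s = trans (*-assoc (p a) (inv (s a)) (s a))
  (trans (cong (p a *_) (inv-inverseˡ (s a) 0<s)) (*-identityʳ (p a)))

density-bound : ∀ {r} a → 0ℚ < s a → density a ≤ r → p a ≤ r * s a
density-bound {r} a 0<s d≤r = subst (_≤ r * s a) (density-* a 0<s)
  (*-monoʳ-≤-nonNeg (s a) {{nonNegative (<⇒≤ 0<s)}} d≤r)

-- Here n = ⌊1/s⌋ is at least 1 because s ≤ 1, hence 1/s < n + 1 ≤ 2n. Multiplying by p gives the
-- strict bound on the density.
copies-P₀ : ∀ a → 0ℚ < p a → 0ℚ < s a → s a ≤ 1ℚ →
            Σ ℕ λ n → P₀ a ≡ ℕ→ℚ n * p a × ℕ→ℚ n * s a ≤ 1ℚ ×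
                      0ℚ < P₀ a × density a < P₀ a + P₀ a
copies-P₀ a 0<p 0<s s≤1 = n , P₀≡ , n*s≤1 , subst (0ℚ <_) (sym P₀≡) (0<* 0<n 0<p) ,
  subst (density a <_) (cong₂ _+_ (sym P₀≡) (sym P₀≡)) density<
  where
  1/s = 1ℚ * inv (s a)
  1/s*s≡1 : 1/s * s a ≡ 1ℚ
  1/s*s≡1 = trans (cong (_* s a) (*-identityˡ (inv (s a)))) (inv-inverseˡ (s a) 0<s)
  0≤1/s : 0ℚ ≤ 1/s
  0≤1/s = 0≤* (<⇒≤ (positive⁻¹ 1ℚ)) (<⇒≤ (inv-positive (s a) 0<s))
  n = proj₁ (floor-ℕ 0≤1/s)
  ⌊1/s⌋≡n = proj₂ (floor-ℕ 0≤1/s)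
  n≤1/s : ℕ→ℚ n ≤ 1/s
  n≤1/s = subst (λ i → ℤ→ℚ i ≤ 1/s) ⌊1/s⌋≡n (floor-lower 1/s)
  1/s<1+n : 1/s < 1ℚ + ℕ→ℚ n
  1/s<1+n = subst (λ i → 1/s < 1ℚ + ℤ→ℚ i) ⌊1/s⌋≡n (floor-upper 1/s)
  P₀≡ : P₀ a ≡ ℕ→ℚ n * p a
  P₀≡ = trans (cong (λ i → p a * ℤ→ℚ i) ⌊1/s⌋≡n) (*-comm (p a) (ℕ→ℚ n))
  n*s≤1 : ℕ→ℚ n * s a ≤ 1ℚ
  n*s≤1 = subst (ℕ→ℚ n * s a ≤_) 1/s*s≡1 (*-monoʳ-≤-nonNeg (s a) {{nonNegative (<⇒≤ 0<s)}} n≤1/s)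
  1≤1/s : 1ℚ ≤ 1/s
  1≤1/s = *-cancelʳ-≤-pos (s a) {{positive 0<s}} (subst₂ _≤_ (sym (*-identityˡ (s a))) (sym 1/s*s≡1) s≤1)
  1≤n : 1ℚ ≤ ℕ→ℚ n
  1≤n = ℕ→ℚ-mono-≤ {1} {n} (s≤s⁻¹ℕ (ℕ→ℚ-cancel-< {1} {suc n}
    (≤-<-trans 1≤1/s (subst (1/s <_) (sym (ℕ→ℚ-suc n)) 1/s<1+n))))
  0<n : 0ℚ < ℕ→ℚ n
  0<n = <-≤-trans (positive⁻¹ 1ℚ) 1≤n
  density< : density a < ℕ→ℚ n * p a + ℕ→ℚ n * p a
  density< = <-≤-trans
    (subst (_< p a * (1ℚ + ℕ→ℚ n)) (cong (p a *_) (*-identityˡ (inv (s a))))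
      (*-monoʳ-<-pos (p a) {{positive 0<p}} 1/s<1+n))
    (0≤⇒≤ (0≤* (<⇒≤ 0<p) (≤⇒0≤ 1≤n))
      (solve 2 (λ n p → p :* (n :- con 1ℚ) := (n :* p :+ n :* p) :- p :* (con 1ℚ :+ n)) refl (ℕ→ℚ n) (p a)))

-- K / T
δ : ℕ → ℚ
δ κ = ε κ * ¼ * (pos 1 / suc κ)

ε-positive : ∀ κ → 0ℚ < ε κ
ε-positive κ = ½^n-positive (κ ∸ 1)

1/suc-nonNeg : ∀ n → 0ℚ ≤ pos 1 / suc n
1/suc-nonNeg n = nonNegative⁻¹ (pos 1 / suc n) {{normalize-nonNeg 1 (suc n)}}

δ-nonNeg : ∀ κ → 0ℚ ≤ δ κ
δ-nonNeg κ = 0≤* (0≤* (<⇒≤ (ε-positive κ)) (nonNegative⁻¹ ¼)) (1/suc-nonNeg κ)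

sucκ*δ : ∀ κ → ℕ→ℚ (suc κ) * δ κ ≡ ε κ * ¼
sucκ*δ κ = trans
  (solve 3 (λ e k i → k :* (e :* con ¼ :* i) := e :* con ¼ :* (k :* i)) refl (ε κ) (ℕ→ℚ (suc κ)) (pos 1 / suc κ))
  (trans (cong (ε κ * ¼ *_) (ℕ→ℚ*1/n≡1 κ)) (*-identityʳ (ε κ * ¼)))

δ≤1 : ∀ κ → ε κ ≤ ¼ → δ κ ≤ 1ℚ
δ≤1 κ ε≤¼ = ≤-trans
  (subst₂ _≤_ (*-identityˡ (δ κ)) (sucκ*δ κ)
    (*-monoʳ-≤-nonNeg (δ κ) {{nonNegative (δ-nonNeg κ)}} (ℕ→ℚ-mono-≤ {1} {suc κ} (s≤sℕ z≤nℕ))))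
  (≤-trans (*-monoʳ-≤-nonNeg ¼ ε≤¼) (<⇒≤ (from-yes (¼ * ¼ <? 1ℚ))))

-- By Bernoulli, κ + 1 factors 1 - δ cost at most (κ + 1) δ = ε/4 ≤ 1/16 together; the 1/(κ + 1) in
-- K makes this independent of κ.
factor-lower : ∀ κ → ε κ ≤ ¼ → 1ℚ - ¼ * ¼ ≤ factor κ
factor-lower κ ε≤¼ = ≤-trans
  (0≤⇒≤ (≤⇒0≤ (subst (_≤ ¼ * ¼) (sym (sucκ*δ κ)) (*-monoʳ-≤-nonNeg ¼ ε≤¼)))
    (solve 1 (λ x → con (¼ * ¼) :- x := (con 1ℚ :- x) :- (con 1ℚ :- con (¼ * ¼))) refl (ℕ→ℚ (suc κ) * δ κ)))
  (bernoulli (suc κ) (δ-nonNeg κ) (δ≤1 κ ε≤¼))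

-- `ε` is defined with truncated subtraction, so `ε 0` is 1 and the identity fails at κ = 0; the
-- bound on ε excludes this case.
2^κ*½ε≡1 : ∀ κ → ε κ ≤ ¼ → ℕ→ℚ (2 ^ℕ κ) * (½ * ε κ) ≡ 1ℚ
2^κ*½ε≡1 zero ε≤¼ = ⊥-elim (from-no (1ℚ ≤? ¼) ε≤¼)
2^κ*½ε≡1 (suc n) _ = 2^n*½^n≡1 (suc n)

2^suc-double : ∀ k x → ℕ→ℚ (2 ^ℕ suc k) * x ≡ ℕ→ℚ (2 ^ℕ k) * x + ℕ→ℚ (2 ^ℕ k) * x
2^suc-double k x = trans (cong (_* x) (ℕ→ℚ-homo-* 2 (2 ^ℕ k)))
  (solve 2 (λ a x → con (ℕ→ℚ 2) :* a :* x := a :* x :+ a :* x) refl (ℕ→ℚ (2 ^ℕ k)) x)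

-- Why Γ cells fill a level exactly: κ + 1 cancels against the denominator in δ, and 2^(κ+1) · ε/4 =
-- 2^κ · ε/2 remains.
Γ*δ≡1 : ∀ κ → ε κ ≤ ¼ → ℕ→ℚ (Γ κ) * δ κ ≡ 1ℚ
Γ*δ≡1 κ ε≤¼ = begin
  ℕ→ℚ (Γ κ) * δ κ                          ≡⟨ cong (_* δ κ) (ℕ→ℚ-homo-* (2 ^ℕ suc κ) (suc κ)) ⟩
  ℕ→ℚ (2 ^ℕ suc κ) * ℕ→ℚ (suc κ) * δ κ     ≡⟨ *-assoc (ℕ→ℚ (2 ^ℕ suc κ)) (ℕ→ℚ (suc κ)) (δ κ) ⟩
  ℕ→ℚ (2 ^ℕ suc κ) * (ℕ→ℚ (suc κ) * δ κ)   ≡⟨ cong (ℕ→ℚ (2 ^ℕ suc κ) *_) (sucκ*δ κ) ⟩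
  ℕ→ℚ (2 ^ℕ suc κ) * (ε κ * ¼)             ≡⟨ 2^suc-double κ (ε κ * ¼) ⟩
  ℕ→ℚ (2 ^ℕ κ) * (ε κ * ¼) + ℕ→ℚ (2 ^ℕ κ) * (ε κ * ¼)
    ≡⟨ solve 2 (λ a e → a :* (e :* con ¼) :+ a :* (e :* con ¼) := a :* (con ½ :* e)) refl (ℕ→ℚ (2 ^ℕ κ)) (ε κ) ⟩
  ℕ→ℚ (2 ^ℕ κ) * (½ * ε κ)                 ≡⟨ 2^κ*½ε≡1 κ ε≤¼ ⟩
  1ℚ                                       ∎
  where open ≡-Reasoning

Kᵖ≡δ*T : ∀ κ a → Kᵖ κ a ≡ δ κ * Tᵖ κ a
Kᵖ≡δ*T κ a = solve 3 (λ e i t → con ¼ :* i :* e :* t := e :* con ¼ :* i :* t) refl (ε κ) (pos 1 / suc κ) (Tᵖ κ a)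

-- Decidability, the item a_eff^c and tagged copies

_≟ᴵ_ : DecidableEquality Item
a ≟ᴵ b = map′ (λ { (refl , refl) → refl }) (λ { refl → refl , refl }) ((p a ≟ p b) ×-dec (s a ≟ s b))

atMostOne? : {X : Set} {R : X → Set} → Decidable R → Decidable (AtMostOne R)
atMostOne? R? [] = yes tt
atMostOne? R? (x ∷ xs) = (R? x →-dec All.all? (λ y → ¬? (R? y)) xs) ×-dec atMostOne? R? xs

ceiling-positive : ∀ {x} → 0ℚ < x → Σ ℕ λ n → ceiling x ≡ pos (suc n)
ceiling-positive {x} 0<x with ceiling x | ℤ→ℚ-cancel-< {pos 0} {ceiling x} (<-≤-trans 0<x (ceiling-lower x))
... | pos (suc n) | _ = n , refl
... | pos zero | ℤ.+<+ ()

aEffC-exists : ∀ a b → ℤ→ℚ (mEff a b) * s b ≤ 1ℚ →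
               Σ Item λ e → aEffC a b ≡ just e × p e ≡ ℤ→ℚ (mEff a b) * p b × s e ≡ ℤ→ℚ (mEff a b) * s b
aEffC-exists a b fits with ℤ→ℚ (mEff a b) * s b ≤? 1ℚ
... | yes _ = _ , refl , refl , refl
... | no ¬fits = ⊥-elim (¬fits fits)

aEffC-size : ∀ a b {c} → aEffC a b ≡ just c → s c ≡ ℤ→ℚ (mEff a b) * s b
aEffC-size a b eq with ℤ→ℚ (mEff a b) * s b ≤? 1ℚ | eq
... | yes _ | refl = refl
... | no _  | ()

sizeT-inj₁ : ∀ xs → sizeT (map inj₁ xs) ≡ sizeL xs
sizeT-inj₁ [] = refl
sizeT-inj₁ (x ∷ xs) = cong (s x +_) (sizeT-inj₁ xs)

profitT-inj₁ : ∀ xs → profitT (map inj₁ xs) ≡ profitL xs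
profitT-inj₁ [] = refl
profitT-inj₁ (x ∷ xs) = cong (p x +_) (profitT-inj₁ xs)

profitT-inj₂ : ∀ e xs → profitT (inj₂ e ∷ map inj₁ xs) ≡ p e + profitL xs
profitT-inj₂ e xs = cong (p e +_) (profitT-inj₁ xs)

κ≥2 : ∀ κ → ε κ ≤ ¼ → Σ ℕ λ m → suc (suc m) ≡ κ
κ≥2 zero ε≤¼ = ⊥-elim (from-no (1ℚ ≤? ¼) ε≤¼)
κ≥2 (suc zero) ε≤¼ = ⊥-elim (from-no (1ℚ ≤? ¼) ε≤¼)
κ≥2 (suc (suc m)) _ = m , refl

open import Data.List.Membership.DecPropositional _≟ᴵ_ using (_∈?_)

-- Rounding, gluing and combining for a fixed instance

chosen : ∀ {C : Item → Set} {R : ℚ → Set} {m x} → m ≡ just x → MinChoice C R m → C x × R (p x)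
chosen refl (cx , rx , _) = cx , rx

module Instance (κ : ℕ) (I : List Item) (ame aeff : Item) (A At : ℕ → ℕ → Maybe Item)
  (ε≤¼ : ε κ ≤ ¼)
  (bounded : (a : Item) → a ∈ I → (0ℚ < p a × p a ≤ 1ℚ) × (0ℚ < s a × s a ≤ 1ℚ))
  (ame∈I : ame ∈ I)
  (ame-best : (a : Item) → a ∈ I → density a ≤ density ame)
  (aeff∈IS : InIS κ I ame aeff)
  (aeff-best : (a : Item) → InIS κ I ame a → density a ≤ density aeff)
  (specA : SpecA κ I ame A)
  (specĨ : SpecĨ κ ame A At) where

  P T q : ℚ
  P = P₀ ame
  T = Tᵖ κ ame
  q = 1ℚ - δ κ

  pos-p : ∀ {a} → a ∈ I → 0ℚ < p a
  pos-p a∈I = proj₁ (proj₁ (bounded _ a∈I))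

  pos-s : ∀ {a} → a ∈ I → 0ℚ < s a
  pos-s a∈I = proj₁ (proj₂ (bounded _ a∈I))

  P₀-copies = copies-P₀ ame (pos-p ame∈I) (pos-s ame∈I) (proj₂ (proj₂ (bounded _ ame∈I)))

  P-pos : 0ℚ < P
  P-pos = proj₁ (proj₂ (proj₂ (proj₂ P₀-copies)))

  density<2P : density ame < P + P
  density<2P = proj₂ (proj₂ (proj₂ (proj₂ P₀-copies)))

  T-pos : 0ℚ < T
  T-pos = 0<* (0<* (positive⁻¹ ½) (ε-positive κ)) P-pos

  q-nonNeg : 0ℚ ≤ q
  q-nonNeg = ≤⇒0≤ (δ≤1 κ ε≤¼)

  q≤1 : q ≤ 1ℚ
  q≤1 = 0≤⇒≤ (δ-nonNeg κ) (solve 1 (λ d → d := con 1ℚ :- (con 1ℚ :- d)) refl (δ κ))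

  level : ℕ → ℚ
  level k = ℕ→ℚ (2 ^ℕ k) * T

  level-double : ∀ k → level (suc k) ≡ level k + level k
  level-double k = 2^suc-double k T

  level-nonNeg : ∀ k → 0ℚ ≤ level k
  level-nonNeg k = 0≤* (ℕ→ℚ-nonNeg (2 ^ℕ k)) (<⇒≤ T-pos)

  level≤suc : ∀ k → level k ≤ level (suc k)
  level≤suc k = subst₂ _≤_ (+-identityʳ (level k)) (sym (level-double k)) (+-monoʳ-≤ (level k) (level-nonNeg k))

  level-mono : ∀ j k → j ≤ℕ k → level j ≤ level k
  level-mono j zero z≤nℕ = ≤-refl {level 0}
  level-mono j (suc k) j≤1+k = case ℕ.m≤n⇒m<n∨m≡n j≤1+k of λ where
    (inj₁ (s≤sℕ j≤k)) → ≤-trans {level j} {level k} {level (suc k)} (level-mono j k j≤k) (level≤suc k)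
    (inj₂ refl) → ≤-refl {level (suc k)}

  level-κ : level κ ≡ P
  level-κ = trans (sym (*-assoc (ℕ→ℚ (2 ^ℕ κ)) (½ * ε κ) P))
    (trans (cong (_* P) (2^κ*½ε≡1 κ ε≤¼)) (*-identityˡ P))

  level-sucκ : level (suc κ) ≡ P + P
  level-sucκ = trans (level-double κ) (cong₂ _+_ level-κ level-κ)

  Γ*K≡T : ℕ→ℚ (Γ κ) * Kᵖ κ ame ≡ T
  Γ*K≡T = begin
    ℕ→ℚ (Γ κ) * Kᵖ κ ame      ≡⟨ cong (ℕ→ℚ (Γ κ) *_) (Kᵖ≡δ*T κ ame) ⟩
    ℕ→ℚ (Γ κ) * (δ κ * T)     ≡⟨ *-assoc (ℕ→ℚ (Γ κ)) (δ κ) T ⟨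
    ℕ→ℚ (Γ κ) * δ κ * T       ≡⟨ cong (_* T) (Γ*δ≡1 κ ε≤¼) ⟩
    1ℚ * T                    ≡⟨ *-identityˡ T ⟩
    T                         ∎
    where open ≡-Reasoning

  K-nonNeg : 0ℚ ≤ Kᵖ κ ame
  K-nonNeg = subst (0ℚ ≤_) (sym (Kᵖ≡δ*T κ ame)) (0≤* (δ-nonNeg κ) (<⇒≤ T-pos))

  -- Profit cells, rounding and levels

  cell : ℕ → ℕ → ℚ
  cell k γ = level k + ℕ→ℚ γ * ℕ→ℚ (2 ^ℕ k) * Kᵖ κ ame

  cell-0 : ∀ k → cell k 0 ≡ level k
  cell-0 k = solve 3 (λ l a b → l :+ con 0ℚ :* a :* b := l) refl (level k) (ℕ→ℚ (2 ^ℕ k)) (Kᵖ κ ame)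

  cell-Γ : ∀ k → cell k (Γ κ) ≡ level (suc k)
  cell-Γ k = trans
    (solve 4 (λ l g a b → l :+ g :* a :* b := l :+ a :* (g :* b)) refl (level k) (ℕ→ℚ (Γ κ)) (ℕ→ℚ (2 ^ℕ k)) (Kᵖ κ ame))
    (trans (cong (λ x → level k + ℕ→ℚ (2 ^ℕ k) * x) Γ*K≡T) (sym (level-double k)))

  cell-mono : ∀ k γ γ' → γ ≤ℕ γ' → cell k γ ≤ cell k γ'
  cell-mono k γ γ' γ≤γ' = +-monoʳ-≤ (level k) (*-monoʳ-≤-nonNeg (Kᵖ κ ame) {{nonNegative K-nonNeg}}
    (*-monoʳ-≤-nonNeg (ℕ→ℚ (2 ^ℕ k)) {{nonNegative (ℕ→ℚ-nonNeg (2 ^ℕ k))}} (ℕ→ℚ-mono-≤ {γ} {γ'} γ≤γ')))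

  cell⊆level : ∀ {k γ x} → γ <ℕ Γ κ → InLkγ κ ame k γ x → InLk κ ame k x
  cell⊆level {k} {γ} {x} γ<Γ (lower , upper) =
    ≤-trans (subst (_≤ cell k γ) (cell-0 k) (cell-mono k 0 γ z≤nℕ)) lower ,
    <-≤-trans upper (subst (cell k (suc γ) ≤_) (cell-Γ k) (cell-mono k (suc γ) (Γ κ) γ<Γ))

  cell-step : ∀ k γ → cell k (suc γ) ≡ cell k γ + δ κ * level k
  cell-step k γ = begin
    level k + ℕ→ℚ (suc γ) * ℕ→ℚ (2 ^ℕ k) * Kᵖ κ ame
      ≡⟨ cong₂ (λ g K → level k + g * ℕ→ℚ (2 ^ℕ k) * K) (ℕ→ℚ-suc γ) (Kᵖ≡δ*T κ ame) ⟩
    level k + (1ℚ + ℕ→ℚ γ) * ℕ→ℚ (2 ^ℕ k) * (δ κ * T)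
      ≡⟨ solve 5 (λ l g a d t → l :+ (con 1ℚ :+ g) :* a :* (d :* t) := (l :+ g :* a :* (d :* t)) :+ d :* (a :* t))
           refl (level k) (ℕ→ℚ γ) (ℕ→ℚ (2 ^ℕ k)) (δ κ) T ⟩
    level k + ℕ→ℚ γ * ℕ→ℚ (2 ^ℕ k) * (δ κ * T) + δ κ * level k
      ≡⟨ cong (λ K → level k + ℕ→ℚ γ * ℕ→ℚ (2 ^ℕ k) * K + δ κ * level k) (Kᵖ≡δ*T κ ame) ⟨
    cell k γ + δ κ * level k ∎
    where open ≡-Reasoning

  -- A cell of level k has width δ · `level k`, which is at most δ y, so replacing `y` by any profit
  -- of its cell loses at most the fraction δ of `y`.
  cell-loss : ∀ {k γ x y} → level k ≤ y → InLkγ κ ame k γ x → InLkγ κ ame k γ y → q * y ≤ x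
  cell-loss {k} {γ} {x} {y} lk≤y (c≤x , _) (_ , y<) =
    0≤⇒≤ (0≤+ (0≤+ (≤⇒0≤ c≤x) (≤⇒0≤ (subst (y ≤_) (cell-step k γ) (<⇒≤ y<)))) (0≤* (δ-nonNeg κ) (≤⇒0≤ lk≤y)))
      (solve 5 (λ x y c d l → x :- c :+ (c :+ d :* l :- y) :+ d :* (y :- l) := x :- (con 1ℚ :- d) :* y)
        refl x y (cell k γ) (δ κ) (level k))

  -- Covers both selections: items of I_L chosen by `A`, and items of I_k together with glued pairs
  -- chosen by `At`.
  choose : ∀ {C : Item → Set} {M : ℕ → Maybe Item} k →
           (∀ γ → γ <ℕ Γ κ → MinChoice C (InLkγ κ ame k γ) (M γ)) → ∀ {y} → C y → InLk κ ame k (p y) →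
           Σ Item λ x → (Σ ℕ λ γ → γ <ℕ Γ κ × M γ ≡ just x) × C x × InLk κ ame k (p x) × s x ≤ s y × q * p y ≤ p x
  choose {C} {M} k minimal {y} cy (l≤y , y<) = pick (M γ) refl (minimal γ γ<Γ)
    where
    found = bracket (cell k) (Γ κ) (subst (_≤ p y) (sym (cell-0 k)) l≤y) (subst (p y <_) (sym (cell-Γ k)) y<)
    γ = proj₁ found
    γ<Γ = proj₁ (proj₂ found)
    y∈cell = proj₂ (proj₂ found)
    pick : ∀ m → M γ ≡ m → MinChoice C (InLkγ κ ame k γ) m →
           Σ Item λ x → (Σ ℕ λ γ → γ <ℕ Γ κ × M γ ≡ just x) × C x × InLk κ ame k (p x) × s x ≤ s y × q * p y ≤ p x
    pick nothing _ none = ⊥-elim (none y cy y∈cell)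
    pick (just x) Mγ≡x (cx , x∈cell , x-min) = x , (γ , γ<Γ , Mγ≡x) , cx ,
      cell⊆level {k} {γ} {p x} γ<Γ x∈cell , x-min y cy y∈cell , cell-loss {k} {γ} {p x} {p y} l≤y x∈cell y∈cell

  -- `SpecĨ` leaves `At` arbitrary above level κ, hence the bound on `k` is part of the predicate.
  Level : ℕ → Item → Set
  Level k x = k ≤ℕ κ × InĨ κ ame A At k x

  InIk-spec : ∀ {k x} → k ≤ℕ κ → InIk κ ame A k x → x ∈ I
  InIk-spec {k} k≤κ ((γ , γ<Γ , eq) , _) = proj₁ (proj₁ (chosen eq (specA k γ k≤κ γ<Γ)))

  Ĩ-spec : ∀ {k x} → k <ℕ κ → InĨ κ ame A At (suc k) x → CandĨ κ ame A At k x × InLk κ ame (suc k) (p x)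
  Ĩ-spec {k} {x} k<κ (γ , γ<Γ , eq) = cand , cell⊆level {suc k} {γ} {p x} γ<Γ x∈cell
    where
    spec = chosen eq (specĨ k γ k<κ γ<Γ)
    cand = proj₁ spec
    x∈cell = proj₂ spec

  Level-bounds : ∀ {k x} → Level k x → InLk κ ame k (p x)
  Level-bounds {zero} (_ , _ , bounds) = bounds
  Level-bounds {suc k} (k<κ , x∈Ĩ) = proj₂ (Ĩ-spec k<κ x∈Ĩ)

  -- The invariant behind the bound 2 P₀: both conditions are additive and so survive gluing.
  Sound : Item → Set
  Sound x = 0ℚ < s x × p x ≤ density ame * s x

  ∈I-sound : ∀ {x} → x ∈ I → Sound x
  ∈I-sound x∈I = pos-s x∈I , density-bound _ (pos-s x∈I) (ame-best _ x∈I)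

  Level-sound : ∀ {k x} → Level k x → Sound x
  Level-sound {zero} (_ , x∈I₀) = ∈I-sound (InIk-spec {0} z≤nℕ x∈I₀)
  Level-sound {suc k} {x} (k<κ , x∈Ĩ) = case proj₁ (Ĩ-spec {k} {x} k<κ x∈Ĩ) of λ where
    (inj₁ x∈Ik) → ∈I-sound (InIk-spec {suc k} {x} k<κ x∈Ik)
    (inj₂ (a , b , a∈ , b∈ , _ , refl)) →
     let 0<a , a≤ = Level-sound {k} {a} (ℕ.<⇒≤ k<κ , a∈)
         0<b , b≤ = Level-sound {k} {b} (ℕ.<⇒≤ k<κ , b∈)
     in +-mono-< {0ℚ} {s a} {0ℚ} {s b} 0<a 0<b , subst (p a + p b ≤_) (sym (*-distribˡ-+ (density ame) (s a) (s b)))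
         (+-mono-≤ {p a} {density ame * s a} {p b} {density ame * s b} a≤ b≤)

  higher : ∀ {i j x} → Level i x → Level j x → ¬ i <ℕ j
  higher {i} {j} {x} xi xj i<j = <-irrefl {p x} {p x} refl
    (<-≤-trans {p x} {level (suc i)} {p x} (proj₂ (Level-bounds {i} {x} xi))
      (≤-trans {level (suc i)} {level j} {p x} (level-mono (suc i) j i<j) (proj₁ (Level-bounds {j} {x} xj))))

  Level-disjoint : ∀ {i j x} → Level i x → Level j x → i ≡ j
  Level-disjoint {i} {j} {x} xi xj = case ℕ.<-cmp i j of λ where
    (tri≈ _ i≡j _) → i≡j
    (tri< i<j _ _) → ⊥-elim (higher {i} {j} xi xj i<j)
    (tri> _ _ j<i) → ⊥-elim (higher {j} {i} xj xi j<i)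

  density-nonNeg : 0ℚ ≤ density ame
  density-nonNeg = 0≤* (<⇒≤ (pos-p ame∈I)) (<⇒≤ (inv-positive (s ame) (pos-s ame∈I)))

  profit<2P : ∀ x y → x ≤ density ame * y → y ≤ 1ℚ → x < P + P
  profit<2P x y x≤ y≤1 = ≤-<-trans {x} {density ame * y} {P + P} x≤ (≤-<-trans {density ame * y} {density ame * 1ℚ} {P + P} (*-scale-≤ (density ame) density-nonNeg y≤1)
    (subst (_< P + P) (sym (*-identityʳ (density ame))) density<2P))

  overflow : ∀ {x y} → Level κ x → Level κ y → s x + s y ≤ 1ℚ → ⊥
  overflow {x} {y} x∈ y∈ fits = <-irrefl {p x + p y} {p x + p y} refl (<-≤-trans {p x + p y} {P + P} {p x + p y}
    (profit<2P (p x + p y) (s x + s y) (subst (p x + p y ≤_) (sym (*-distribˡ-+ (density ame) (s x) (s y)))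
      (+-mono-≤ {p x} {density ame * s x} {p y} {density ame * s y} (proj₂ (Level-sound {κ} {x} x∈)) (proj₂ (Level-sound {κ} {y} y∈)))) fits)
    (+-mono-≤ {P} {p x} {P} {p y} (subst (_≤ p x) level-κ (proj₁ (Level-bounds {κ} {x} x∈)))
              (subst (_≤ p y) level-κ (proj₁ (Level-bounds {κ} {y} y∈)))))

  promote : ∀ {k y} → k <ℕ κ → CandĨ κ ame A At k y → InLk κ ame (suc k) (p y) →
            Σ Item λ x → Level (suc k) x × s x ≤ s y × q * p y ≤ p x
  promote {k} k<κ cand bounds =
    let x , x∈Ĩ , _ , _ , size≤ , profit≤ = choose (suc k) (λ γ → specĨ k γ k<κ) cand bounds
    in x , (k<κ , x∈Ĩ) , size≤ , profit≤

  glue : ∀ {k x y} → k <ℕ κ → Level k x → Level k y → s x + s y ≤ 1ℚ →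
         Σ Item λ z → Level (suc k) z × s z ≤ s x + s y × q * (p x + p y) ≤ p z
  glue {k} {x} {y} k<κ x∈ y∈ fits =
    promote k<κ (inj₂ (x , y , proj₂ x∈ , proj₂ y∈ , fits , refl))
      (subst (_≤ p x + p y) (sym (level-double k)) (+-mono-≤ {level k} {p x} {level k} {p y} (proj₁ x-bounds) (proj₁ y-bounds)) ,
       subst (p x + p y <_) (sym (level-double (suc k))) (+-mono-< {p x} {level (suc k)} {p y} {level (suc k)} (proj₂ x-bounds) (proj₂ y-bounds)))
    where
    x-bounds = Level-bounds {k} {x} x∈
    y-bounds = Level-bounds {k} {y} y∈

  -- Turning a solution into a counter

  open Gluing Level κ q q-nonNeg (λ {k} x∈ → <⇒≤ (proj₁ (Level-sound {k} x∈))) (λ {k} → glue {k}) overflow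

  -- This is the count of roundings. At level 0 only the choice by `A` rounds and κ slots lie above,
  -- giving κ + 1 factors. At level k ≥ 1 the choices by `A` and by `At` both round and κ - k slots
  -- lie above, giving κ - k + 2 ≤ κ + 1 factors.
  place : ∀ {a} → a ∈ I → T ≤ p a →
          Σ ℕ λ j → Σ ℕ λ n → Σ Item λ x → j +ℕ n ≡ κ × Level j x × s x ≤ s a × q ^ suc κ * p a ≤ q ^ n * p x
  place {a} a∈I T≤a = at (proj₁ found) (s≤s⁻¹ℕ (proj₁ (proj₂ found))) (proj₂ (proj₂ found))
    where
    -- The levels 0, ..., κ cover [T, 2 P₀), and a single item already obeys the bound 2 P₀.
    found = bracket level (suc κ) (subst (_≤ p a) (sym (*-identityˡ T)) T≤a)
      (subst (p a <_) (sym level-sucκ) (profit<2P (p a) (s a) (proj₂ (∈I-sound a∈I)) (proj₂ (proj₂ (bounded a a∈I)))))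
    at : ∀ k → k ≤ℕ κ → InLk κ ame k (p a) →
         Σ ℕ λ j → Σ ℕ λ n → Σ Item λ x → j +ℕ n ≡ κ × Level j x × s x ≤ s a × q ^ suc κ * p a ≤ q ^ n * p x
    at zero _ bounds =
      let x , x∈A , _ , x-bounds , size≤ , profit≤ = choose 0 (λ γ → specA 0 γ z≤nℕ) (a∈I , T≤a) bounds
      in 0 , κ , x , refl , (z≤nℕ , x∈A , x-bounds) , size≤ ,
      0≤⇒≤ (0≤* (^-nonNeg κ q-nonNeg) (≤⇒0≤ profit≤))
        (solve 4 (λ q Q a x → Q :* (x :- q :* a) := Q :* x :- q :* Q :* a) refl q (q ^ κ) (p a) (p x))
    at (suc k) k<κ bounds =
      let x , x∈A , _ , x-bounds , size≤ , profit≤ = choose (suc k) (λ γ → specA (suc k) γ k<κ) (a∈I , T≤a) bounds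
          y , y∈ , y≤x , x≤y = promote k<κ (inj₁ (x∈A , x-bounds)) x-bounds
          n = κ ∸ suc k
      in suc k , n , y , ℕ.m+[n∸m]≡n k<κ , y∈ , ≤-trans {s y} {s x} {s a} y≤x size≤ ,
         ≤-trans (*-monoʳ-≤-nonNeg (p a) {{nonNegative (<⇒≤ (pos-p a∈I))}}
             (^-antimono {m = suc (suc n)} q-nonNeg q≤1 (s≤sℕ (ℕ.≤-trans (ℕ.m≤n+m (suc n) k)
               (ℕ.≤-reflexive (trans (ℕ.+-suc k n) (ℕ.m+[n∸m]≡n k<κ)))))))
           (0≤⇒≤ (0≤+ (0≤* (^-nonNeg n q-nonNeg) (≤⇒0≤ x≤y))
                      (0≤* (^-nonNeg (suc n) q-nonNeg) (≤⇒0≤ profit≤)))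
             (solve 5 (λ q Q a x y → Q :* (y :- q :* x) :+ q :* Q :* (x :- q :* a) := Q :* y :- q :* (q :* Q) :* a)
               refl q (q ^ n) (p a) (p x) (p y)))

  ρ : ℚ
  ρ = density aeff

  aeff∈I : aeff ∈ I
  aeff∈I = proj₁ aeff∈IS

  ρ-nonNeg : 0ℚ ≤ ρ
  ρ-nonNeg = 0≤* (<⇒≤ (pos-p aeff∈I)) (<⇒≤ (inv-positive (s aeff) (pos-s aeff∈I)))

  -- σ collects the space of the small items, whose profit is at most ρ σ because a_eff is the
  -- densest of them. Counting σ in the size bound reserves this space while large items are
  -- inserted.
  structure : ∀ zs → All (_∈ I) zs → sizeL zs ≤ 1ℚ →
    Σ (List Item) λ xs → Σ (Counter Level 0 (suc κ) xs) λ c → Σ ℚ λ σ →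
      0ℚ ≤ σ × sizeL xs + σ ≤ sizeL zs × q ^ suc κ * profitL zs ≤ weight q c + ρ * σ
  structure [] [] _ = [] , counter-empty 0 (suc κ) , 0ℚ , ≤-refl , ≤-refl ,
    ≤-reflexive (trans (*-zeroʳ (q ^ suc κ)) (sym (cong₂ _+_ (weight-empty q 0 (suc κ)) (*-zeroʳ ρ))))
  structure (a ∷ zs) (a∈I ∷ zs⊆I) fits = case T ≤? p a of λ where
      (yes T≤a) → large T≤a
      (no T≰a) → small (≰⇒> T≰a)
    where
    Result = Σ (List Item) λ xs → Σ (Counter Level 0 (suc κ) xs) λ c → Σ ℚ λ σ →
      0ℚ ≤ σ × sizeL xs + σ ≤ s a + sizeL zs × q ^ suc κ * (p a + profitL zs) ≤ weight q c + ρ * σ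
    zs≤1 : sizeL zs ≤ 1ℚ
    zs≤1 = ≤-trans {sizeL zs} {s a + sizeL zs} {1ℚ} (subst (_≤ s a + sizeL zs) (+-identityˡ (sizeL zs))
      (+-monoˡ-≤ (sizeL zs) (<⇒≤ (pos-s a∈I)))) fits
    rest = structure zs zs⊆I zs≤1
    xs = proj₁ rest
    c = proj₁ (proj₂ rest)
    σ = proj₁ (proj₂ (proj₂ rest))
    0≤σ = proj₁ (proj₂ (proj₂ (proj₂ rest)))
    size≤ = proj₁ (proj₂ (proj₂ (proj₂ (proj₂ rest))))
    profit≤ = proj₂ (proj₂ (proj₂ (proj₂ (proj₂ rest))))
    large : T ≤ p a → Result
    large T≤a =
      let j , n , x , j+n≡κ , x∈ , x≤a , a≤x = place a∈I T≤a
          x+xs+σ≤ = +-mono-≤ {s x} {s a} {sizeL xs + σ} {sizeL zs} x≤a size≤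
          ys , d , ys≤ , w≤ = insertLevel {xs} {x} {j} n j+n≡κ x∈ c
            (≤-trans {s x + sizeL xs} {s a + sizeL zs} {1ℚ} (0≤⇒≤ (0≤+ (≤⇒0≤ x+xs+σ≤) 0≤σ)
              (solve 4 (λ x y σ z → (z :- (x :+ (y :+ σ))) :+ σ := z :- (x :+ y)) refl (s x) (sizeL xs) σ (s a + sizeL zs)))
              fits)
      in ys , d , σ , 0≤σ ,
         0≤⇒≤ (0≤+ (≤⇒0≤ ys≤) (≤⇒0≤ x+xs+σ≤))
           (solve 5 (λ x y σ z v → (x :+ y :- v) :+ (z :- (x :+ (y :+ σ))) := z :- (v :+ σ)) refl
             (s x) (sizeL xs) σ (s a + sizeL zs) (sizeL ys)) ,
         0≤⇒≤ (0≤+ (0≤+ (≤⇒0≤ profit≤) (≤⇒0≤ a≤x)) (≤⇒0≤ w≤))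
           (solve 7 (λ Q a z w r x d → (w :+ r :- Q :* z) :+ (x :- Q :* a) :+ (d :- (x :+ w)) := (d :+ r) :- Q :* (a :+ z))
             refl (q ^ suc κ) (p a) (profitL zs) (weight q c) (ρ * σ) (q ^ n * p x) (weight q d))
    small : p a < T → Result
    small a<T = xs , c , s a + σ , 0≤+ (<⇒≤ (pos-s a∈I)) 0≤σ ,
      0≤⇒≤ (≤⇒0≤ size≤) (solve 4 (λ x a σ z → z :- (x :+ σ) := (a :+ z) :- (x :+ (a :+ σ))) refl (sizeL xs) (s a) σ (sizeL zs)) ,
      0≤⇒≤ (0≤+ (0≤+ (≤⇒0≤ profit≤) (≤⇒0≤ (density-bound a (pos-s a∈I) (aeff-best a (a∈I , a<T)))))
                (0≤* (≤⇒0≤ (^-antimono {m = 0} {n = suc κ} q-nonNeg q≤1 z≤nℕ)) (<⇒≤ (pos-p a∈I))))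
        (solve 7 (λ Q a z w r σ t → (w :+ r :* σ :- Q :* z) :+ (r :* t :- a) :+ (con 1ℚ :- Q) :* a := (w :+ r :* (t :+ σ)) :- Q :* (a :+ z))
          refl (q ^ suc κ) (p a) (profitL zs) (weight q c) ρ σ (s a))

  -- Decidability and finiteness for structured solutions

  InIk? : ∀ k → Decidable (InIk κ ame A k)
  InIk? k x = ℕ.anyUpTo? (λ γ → Maybe.≡-dec _≟ᴵ_ (A k γ) (just x)) (Γ κ) ×-dec
              ((level k ≤? p x) ×-dec (p x <? level (suc k)))

  InĨ? : ∀ k → Decidable (InĨ κ ame A At k)
  InĨ? zero x = InIk? zero x
  InĨ? (suc k) x = ℕ.anyUpTo? (λ γ → Maybe.≡-dec _≟ᴵ_ (At (suc k) γ) (just x)) (Γ κ)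

  InG? : Decidable (InG κ ame A At)
  InG? x = map′ (λ { (k , s≤sℕ k≤κ , x∈) → k , k≤κ , x∈ }) (λ { (k , k≤κ , x∈) → k , s≤sℕ k≤κ , x∈ })
    (ℕ.anyUpTo? (λ k → InĨ? k x) (suc κ))

  ElemS? : Decidable (ElemS κ ame aeff A At)
  ElemS? (inj₁ x) = InG? x
  ElemS? (inj₂ x) = Maybe.≡-dec _≟ᴵ_ (aEffC ame aeff) (just x)

  FromĨ? : ∀ k → Decidable (FromĨ κ ame A At k)
  FromĨ? k (inj₁ x) = InĨ? k x
  FromĨ? k (inj₂ x) = no λ ()

  IsExtra? : Decidable IsExtra
  IsExtra? (inj₁ _) = no λ ()
  IsExtra? (inj₂ _) = yes tt

  StructFeasible? : ∀ v → Decidable (StructFeasible κ ame aeff A At v)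
  StructFeasible? v xs =
    All.all? ElemS? xs ×-dec (sizeT xs ≤? v) ×-dec
    map′ (λ once k k≤κ → once (s≤sℕ k≤κ)) (λ { once (s≤sℕ k≤κ) → once _ k≤κ })
      (ℕ.allUpTo? (λ k → atMostOne? (FromĨ? k) xs) (suc κ)) ×-dec
    atMostOne? IsExtra? xs ×-dec
    Any.any? (λ e → FromĨ? (κ ∸ 2) e ⊎-dec (FromĨ? (κ ∸ 1) e ⊎-dec (FromĨ? κ e ⊎-dec IsExtra? e))) xs

  InĨ-finite : ∀ k → Finite (InĨ κ ame A At k)
  InĨ-finite zero = finite-⊆ (λ x → proj₁) (finite-∃< (λ γ → finite-just (A zero γ)) (Γ κ))
  InĨ-finite (suc k) = finite-∃< (λ γ → finite-just (At (suc k) γ)) (Γ κ)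

  ElemS-finite : Finite (ElemS κ ame aeff A At)
  ElemS-finite = finite-⊆
    (λ { (inj₁ x) (k , k≤κ , x∈) → inj₁ (x , (k , s≤sℕ k≤κ , x∈) , refl)
       ; (inj₂ x) x≡ → inj₂ (x , x≡ , refl) })
    (finite-⊎ (finite-map inj₁ (finite-∃< InĨ-finite (suc κ))) (finite-map inj₂ (finite-just (aEffC ame aeff))))

  -- The number of copies in a_eff^c, and existence of the optima

  quarter-ratio : ℚ
  quarter-ratio = (P * ¼) * inv (p aeff)

  pos-pe : 0ℚ < p aeff
  pos-pe = pos-p aeff∈I

  pos-se : 0ℚ < s aeff
  pos-se = pos-s aeff∈I

  ratio*pe : quarter-ratio * p aeff ≡ P * ¼
  ratio*pe = trans (*-assoc (P * ¼) (inv (p aeff)) (p aeff))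
    (trans (cong (P * ¼ *_) (inv-inverseˡ (p aeff) pos-pe)) (*-identityʳ (P * ¼)))

  -- With at least one copy inside, a_eff^c has positive size, as the length bound on structured
  -- solutions demands.
  mEff-positive : Σ ℕ λ n → mEff ame aeff ≡ pos (suc n)
  mEff-positive = ceiling-positive {quarter-ratio}
    (0<* (0<* P-pos (positive⁻¹ ¼)) (inv-positive (p aeff) pos-pe))

  m-eff : ℕ
  m-eff = suc (proj₁ mEff-positive)

  m≡ : ℤ→ℚ (mEff ame aeff) ≡ ℕ→ℚ m-eff
  m≡ = cong ℤ→ℚ (proj₂ mEff-positive)

  -- The ceiling of r is below 1 + r, and n copies worth P₀/4 force r ≤ n, so `m-eff` < n + 1.
  m-minimal : ∀ n → P * ¼ ≤ ℕ→ℚ n * p aeff → m-eff ≤ℕ n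
  m-minimal n P/4≤ = s≤s⁻¹ℕ (ℕ→ℚ-cancel-< {m-eff} {suc n}
    (<-≤-trans {ℕ→ℚ m-eff} {1ℚ + quarter-ratio} {ℕ→ℚ (suc n)} (subst (_< 1ℚ + quarter-ratio) m≡ (ceiling-upper quarter-ratio))
      (subst (1ℚ + quarter-ratio ≤_) (sym (ℕ→ℚ-suc n)) (+-monoʳ-≤ 1ℚ
        (*-cancelʳ-≤-pos {quarter-ratio} {ℕ→ℚ n} (p aeff) {{positive pos-pe}} (subst (_≤ ℕ→ℚ n * p aeff) (sym ratio*pe) P/4≤))))))

  ElemS-pos : ∀ e → ElemS κ ame aeff A At e → 0ℚ < s (untag e)
  ElemS-pos (inj₁ x) (k , k≤κ , x∈) = proj₁ (Level-sound {k} {x} (k≤κ , x∈))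
  ElemS-pos (inj₂ c) c≡ = subst (0ℚ <_) (sym (trans (aEffC-size ame aeff c≡) (cong (_* s aeff) m≡)))
    (0<* (<-≤-trans (positive⁻¹ 1ℚ) (ℕ→ℚ-mono-≤ {1} {m-eff} (s≤sℕ z≤nℕ))) pos-se)

  struct-optimum : ∀ {v xs} → v ≤ 1ℚ → StructFeasible κ ame aeff A At v xs →
                   Σ ℚ λ o → IsOPTS κ ame aeff A At v o × profitT xs ≤ o
  struct-optimum {v} v≤1 feasible =
    let o , best , ≤o = Knapsack.optimum (s ∘ untag) sizeT profitT refl (λ _ _ → refl)
          ElemS-finite ElemS-pos ElemS? (StructFeasible? v)
          (λ {xs} f → proj₁ f , ≤-trans {sizeT xs} {v} {1ℚ} (proj₁ (proj₂ f)) v≤1) feasible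
    in o , inj₁ best , ≤o

  -- Used for OPT(I), where copies of a_me give the lower bound P₀, and for the copies of a_eff in
  -- the remaining space.
  item-optimum : ∀ {E : Item → Set} {v} → Finite E → (∀ x → E x → 0ℚ < s x) → Decidable E → v ≤ 1ℚ →
                 ∀ {a} n → E a → ℕ→ℚ n * s a ≤ v → Σ ℚ λ o → IsOPT v E o × ℕ→ℚ n * p a ≤ o
  item-optimum {E} {v} finite E-pos E? v≤1 {a} n a∈E fits =
    let o , best , ≤o = Knapsack.optimum s sizeL profitL refl (λ _ _ → refl) finite E-pos E?
          (λ xs → All.all? E? xs ×-dec (sizeL xs ≤? v))
          (λ {xs} f → proj₁ f , ≤-trans {sizeL xs} {v} {1ℚ} (proj₂ f) v≤1)
          {replicate n a} (All-replicate⁺ n a∈E , subst (_≤ v) (sym (size-replicate n a)) fits)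
    in o , best , subst (_≤ o) (profit-replicate n a) ≤o

  -- Assembling the structured solution

  Goal : Set
  Goal = Σ ℚ (λ v → (0ℚ ≤ v × v ≤ 1ℚ) ×
    Σ ℚ (λ o₁ → IsOPTS κ ame aeff A At v o₁ ×
    Σ ℚ (λ o₂ → IsOPT (1ℚ - v) (λ a → a ≡ aeff) o₂ ×
    ((o : ℚ) → IsOPT 1ℚ (λ a → a ∈ I) o →
    factor κ * o - T ≤ o₁ + o₂))))

  factor-nonNeg : 0ℚ ≤ factor κ
  factor-nonNeg = ^-nonNeg (suc κ) q-nonNeg

  -- The bound is demanded for every `o` that is optimal for I. Its witnessing list is feasible, so
  -- `o ≤ o*`, and a nonnegative `factor` transfers the gain from `o*` to `o`.
  combine : ∀ v xs n o* w → profitT xs ≡ w → 0ℚ ≤ v → ℕ→ℚ n * s aeff ≤ 1ℚ - v → StructFeasible κ ame aeff A At v xs →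
            IsOPT 1ℚ (_∈ I) o* → factor κ * o* - T ≤ w + ℕ→ℚ n * p aeff → Goal
  combine v xs n o* w xs≡w 0≤v n-fits feasible (_ , o*-max) gain =
    let o₁ , opt₁ , xs≤o₁ = struct-optimum {v} {xs} v≤1 feasible
        o₂ , opt₂ , n≤o₂ = item-optimum {_≡ aeff} {1ℚ - v} (aeff ∷ [] , λ { _ refl → here refl }) (λ { _ refl → pos-se })
          (_≟ᴵ aeff) 1-v≤1 n refl n-fits
    in v , (0≤v , v≤1) , o₁ , opt₁ , o₂ , opt₂ ,
       λ { o ((zs , f , zs≡o) , _) →
         0≤⇒≤ (0≤+ (0≤+ (≤⇒0≤ gain) (0≤+ (≤⇒0≤ (subst (_≤ o₁) xs≡w xs≤o₁)) (≤⇒0≤ n≤o₂)))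
                    (0≤* factor-nonNeg (≤⇒0≤ (subst (_≤ o*) zs≡o (o*-max zs f)))))
           (solve 8 (λ F o o* t x y a b → (x :+ y :- (F :* o* :- t)) :+ ((a :- x) :+ (b :- y)) :+ F :* (o* :- o) := (a :+ b) :- (F :* o :- t))
             refl (factor κ) o o* T w (ℕ→ℚ n * p aeff) o₁ o₂) }
    where
    v≤1 : v ≤ 1ℚ
    v≤1 = 0≤⇒≤ (0≤+ (≤⇒0≤ n-fits) (0≤* (ℕ→ℚ-nonNeg n) (<⇒≤ pos-se)))
      (solve 2 (λ v x → con 1ℚ :- v :- x :+ x := con 1ℚ :- v) refl v (ℕ→ℚ n * s aeff))
    1-v≤1 : 1ℚ - v ≤ 1ℚ
    1-v≤1 = 0≤⇒≤ 0≤v (solve 1 (λ v → v := con 1ℚ :- (con 1ℚ :- v)) refl v)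

  counter-elems : ∀ {xs} → Counter Level 0 (suc κ) xs → All (ElemS κ ame aeff A At) (map inj₁ xs)
  counter-elems c = All-map⁺ (All.map (λ { (j , _ , j≤κ , x∈) → j , j≤κ , x∈ }) (counter-levels c))

  counter-once : ∀ {xs} → Counter Level 0 (suc κ) xs → ∀ k → k ≤ℕ κ → AtMostOne (FromĨ κ ame A At k) (map inj₁ xs)
  counter-once {xs} c k k≤κ = atMostOne-map inj₁ (λ x x∈ → k≤κ , x∈) xs
    (counter-atMostOne (λ {i} {j} {x} → Level-disjoint {i} {j} {x}) c k)

  no-extra : ∀ xs → All (¬_ ∘ IsExtra) (map inj₁ xs)
  no-extra xs = All-map⁺ (All.universal (λ _ ()) xs)

  without-extra : ∀ {xs m} → suc (suc m) ≡ κ → Counter Level 0 (suc κ) xs →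
                  Any (λ x → Level m x ⊎ Level (suc m) x ⊎ Level (suc (suc m)) x) xs →
                  StructFeasible κ ame aeff A At (sizeL xs) (map inj₁ xs)
  without-extra {xs} κ≡ c top = counter-elems c , ≤-reflexive (sizeT-inj₁ xs) , counter-once c ,
    atMostOne-none (no-extra xs) ,
    Any-map⁺ (Any.map (λ {x} →
      Sum.map (λ l → subst (λ k → InĨ κ ame A At (k ∸ 2) x) κ≡ (proj₂ l))
        (Sum.map (λ l → subst (λ k → InĨ κ ame A At (k ∸ 1) x) κ≡ (proj₂ l))
          (λ l → inj₁ (subst (λ k → InĨ κ ame A At k x) κ≡ (proj₂ l))))) top)

  -- The tag `inj₂` keeps a_eff^c out of every Ĩ_k even if it equals an item of G, and this copy
  -- alone meets the lower-bound condition.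
  with-extra : ∀ {xs e} → Counter Level 0 (suc κ) xs → aEffC ame aeff ≡ just e →
               StructFeasible κ ame aeff A At (s e + sizeL xs) (inj₂ e ∷ map inj₁ xs)
  with-extra {xs} {e} c e≡ = e≡ ∷ counter-elems c , ≤-reflexive (cong (s e +_) (sizeT-inj₁ xs)) ,
    (λ k k≤κ → (λ ()) , counter-once c k k≤κ) ,
    ((λ _ → no-extra xs) , atMostOne-none (no-extra xs)) ,
    here (inj₂ (inj₂ (inj₂ tt)))

  counter-size-nonNeg : ∀ {xs} → Counter Level 0 (suc κ) xs → 0ℚ ≤ sizeL xs
  counter-size-nonNeg c =
    sizeL-nonNeg (All.map (λ { {x} (j , _ , l) → <⇒≤ (proj₁ (Level-sound {j} {x} l)) }) (counter-levels c))

  -- Of the m + r copies of a_eff, m move as one glued item into the structured part and r stay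
  -- behind; v grows by the size of the m copies, and total size and profit are unchanged.
  combine-with-extra : ∀ {xs o*} m r → Counter Level 0 (suc κ) xs → IsOPT 1ℚ (_∈ I) o* → ℤ→ℚ (mEff ame aeff) ≡ ℕ→ℚ m →
    ℕ→ℚ (m +ℕ r) * s aeff ≤ 1ℚ - sizeL xs → factor κ * o* - T ≤ profitL xs + ℕ→ℚ (m +ℕ r) * p aeff → Goal
  combine-with-extra {xs} {o*} m r c opt mEff≡m fits gain =
    let e , e≡ , pe , se = aEffC-exists ame aeff (subst (λ k → k * s aeff ≤ 1ℚ) (sym mEff≡m) m-fits)
        pe' = trans pe (cong (_* p aeff) mEff≡m)
        se' = trans se (cong (_* s aeff) mEff≡m)
    in combine (s e + sizeL xs) (inj₂ e ∷ map inj₁ xs) r o* (p e + profitL xs) (profitT-inj₂ e xs)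
      (subst (λ k → 0ℚ ≤ k + sizeL xs) (sym se') (0≤+ m-nonNeg xs-nonNeg))
      (subst (λ k → ℕ→ℚ r * s aeff ≤ 1ℚ - (k + sizeL xs)) (sym se') r-fits)
      (with-extra c e≡) opt
      (subst (λ k → factor κ * o* - T ≤ k + profitL xs + ℕ→ℚ r * p aeff) (sym pe')
        (subst (factor κ * o* - T ≤_) regroup gain))
    where
    xs-nonNeg : 0ℚ ≤ sizeL xs
    xs-nonNeg = counter-size-nonNeg c
    m-nonNeg : 0ℚ ≤ ℕ→ℚ m * s aeff
    m-nonNeg = 0≤* (ℕ→ℚ-nonNeg m) (<⇒≤ pos-se)
    r-fits : ℕ→ℚ r * s aeff ≤ 1ℚ - (ℕ→ℚ m * s aeff + sizeL xs)
    r-fits = 0≤⇒≤ (≤⇒0≤ fits) (trans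
      (cong (λ k → 1ℚ - sizeL xs - k * s aeff) (ℕ→ℚ-homo-+ m r))
      (solve 4 (λ x m r a → con 1ℚ :- x :- (m :+ r) :* a := con 1ℚ :- (m :* a :+ x) :- r :* a) refl
        (sizeL xs) (ℕ→ℚ m) (ℕ→ℚ r) (s aeff)))
    m-fits : ℕ→ℚ m * s aeff ≤ 1ℚ
    m-fits = 0≤⇒≤ (0≤+ (0≤+ (≤⇒0≤ r-fits) (0≤* (ℕ→ℚ-nonNeg r) (<⇒≤ pos-se))) xs-nonNeg)
      (solve 3 (λ e x y → con 1ℚ :- (e :+ x) :- y :+ y :+ x := con 1ℚ :- e) refl
        (ℕ→ℚ m * s aeff) (sizeL xs) (ℕ→ℚ r * s aeff))
    regroup : profitL xs + ℕ→ℚ (m +ℕ r) * p aeff ≡ ℕ→ℚ m * p aeff + profitL xs + ℕ→ℚ r * p aeff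
    regroup = trans (cong (λ k → profitL xs + k * p aeff) (ℕ→ℚ-homo-+ m r))
      (solve 4 (λ x m r a → x :+ (m :+ r) :* a := m :* a :+ x :+ r :* a) refl (profitL xs) (ℕ→ℚ m) (ℕ→ℚ r) (p aeff))

  level-half : ∀ {m} → suc (suc m) ≡ κ → level (suc m) ≡ ½ * P
  level-half {m} κ≡ = trans (solve 1 (λ l → l := con ½ :* (l :+ l)) refl (level (suc m)))
    (cong (½ *_) (trans (sym (level-double (suc m))) (trans (cong level κ≡) level-κ)))

  -- (1 − 1/16) P₀ − T ≥ (13/16) P₀, of which the counter provides at most half of P₀.
  many-small : ∀ {x y o*} → P ≤ o* → factor κ * o* - T ≤ x + y → x + level 1 ≤ ½ * P → P * ¼ ≤ y
  many-small {x} {y} {o*} P≤o* gain cheap = 0≤⇒≤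
    (0≤+ (0≤+ (0≤+ (0≤+ (0≤+ (≤⇒0≤ gain) (0≤* factor-nonNeg (≤⇒0≤ P≤o*)))
      (0≤* (≤⇒0≤ (factor-lower κ ε≤¼)) (<⇒≤ P-pos)))
      (0≤* (0≤* (≤⇒0≤ ε≤¼) (nonNegative⁻¹ ½)) (<⇒≤ P-pos)))
      (0≤+ (≤⇒0≤ cheap) (level-nonNeg 1)))
      (0≤* (nonNegative⁻¹ (¼ * ¼)) (<⇒≤ P-pos)))
    (solve 7 (λ F o P e x l y →
        (x :+ y :- (F :* o :- con ½ :* e :* P)) :+ F :* (o :- P) :+ (F :- (con 1ℚ :- con (¼ * ¼))) :* P
          :+ (con ¼ :- e) :* con ½ :* P :+ ((con ½ :* P :- (x :+ l)) :+ l) :+ con (¼ * ¼) :* P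
        := y :- P :* con ¼)
      refl (factor κ) o* P (ε κ) x (level 1) y)

  conclude : ∀ {xs o* m} n → suc (suc m) ≡ κ → Counter Level 0 (suc κ) xs → IsOPT 1ℚ (_∈ I) o* → P ≤ o* →
             ℕ→ℚ n * s aeff ≤ 1ℚ - sizeL xs → factor κ * o* - T ≤ profitL xs + ℕ→ℚ n * p aeff → Goal
  conclude {xs} {o*} {m} n κ≡ c opt P≤o* fits gain =
    case top-or-cheap level level-double level-nonNeg (λ {k} {x} l → <⇒≤ (proj₂ (Level-bounds {k} {x} l)))
           m (ℕ.+-identityʳ m) (subst (λ k → Counter Level 0 k xs) suc-κ c) of λ where
      (inj₁ top) → combine (sizeL xs) (map inj₁ xs) n o* (profitL xs) (profitT-inj₁ xs) (counter-size-nonNeg c) fits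
        (without-extra κ≡ c top) opt gain
      (inj₂ cheap) → extra (m-minimal n (many-small {profitL xs} {ℕ→ℚ n * p aeff} {o*} P≤o* gain
        (subst (profitL xs + level 1 ≤_) (level-half κ≡) cheap)))
    where
    suc-κ : suc κ ≡ m +ℕ 3
    suc-κ = trans (cong suc (sym κ≡)) (ℕ.+-comm 3 m)
    extra : m-eff ≤ℕ n → Goal
    extra m≤n = combine-with-extra {xs} {o*} m-eff (n ∸ m-eff) c opt m≡
      (subst (λ k → ℕ→ℚ k * s aeff ≤ 1ℚ - sizeL xs) (sym (ℕ.m+[n∸m]≡n m≤n)) fits)
      (subst (λ k → factor κ * o* - T ≤ profitL xs + ℕ→ℚ k * p aeff) (sym (ℕ.m+[n∸m]≡n m≤n)) gain)

  -- Rounding the space σ of the small items down to copies of a_eff loses less than p(a_eff) < T.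
  round-small : ∀ {xs σ o*} n (c : Counter Level 0 (suc κ) xs) → σ < (1ℚ + ℕ→ℚ n) * s aeff →
                factor κ * o* ≤ weight q c + ρ * σ → factor κ * o* - T ≤ profitL xs + ℕ→ℚ n * p aeff
  round-small {xs} {σ} {o*} n c σ<1+n profit≤ =
    0≤⇒≤ (0≤+ (0≤+ (0≤+ (≤⇒0≤ profit≤) (≤⇒0≤ weight≤)) (≤⇒0≤ ρσ≤)) (≤⇒0≤ (<⇒≤ (proj₂ aeff∈IS))))
      (solve 7 (λ z w r x n a t → (w :+ r :- z) :+ (x :- w) :+ ((con 1ℚ :+ n) :* a :- r) :+ (t :- a) := (x :+ n :* a) :- (z :- t))
        refl (factor κ * o*) (weight q c) (ρ * σ) (profitL xs) (ℕ→ℚ n) (p aeff) T)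
    where
    weight≤ : weight q c ≤ profitL xs
    weight≤ = weight≤profit
      (λ {k} {x} l → ≤-trans {0ℚ} {level k} {p x} (level-nonNeg k) (proj₁ (Level-bounds {k} {x} l))) q-nonNeg q≤1 c
    ρσ≤ : ρ * σ ≤ (1ℚ + ℕ→ℚ n) * p aeff
    ρσ≤ = subst (ρ * σ ≤_)
      (trans (solve 3 (λ r n t → r :* ((con 1ℚ :+ n) :* t) := (con 1ℚ :+ n) :* (r :* t)) refl ρ (ℕ→ℚ n) (s aeff))
        (cong ((1ℚ + ℕ→ℚ n) *_) (density-* aeff pos-se)))
      (*-scale-≤ ρ ρ-nonNeg (<⇒≤ σ<1+n))

  copies-fit : ∀ {x y z σ} → x + σ ≤ z → z ≤ 1ℚ → y ≤ σ → y ≤ 1ℚ - x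
  copies-fit {x} {y} {z} {σ} x+σ≤z z≤1 y≤σ = 0≤⇒≤ (0≤+ (0≤+ (≤⇒0≤ x+σ≤z) (≤⇒0≤ z≤1)) (≤⇒0≤ y≤σ))
    (solve 4 (λ x σ z y → (z :- (x :+ σ)) :+ (con 1ℚ :- z) :+ (σ :- y) := con 1ℚ :- x :- y) refl x σ z y)

  split-optimum : Goal
  split-optimum =
    let N , P≡ , N-fits , _ = P₀-copies
        o* , opt , P≤ = item-optimum {_∈ I} {1ℚ} (I , λ _ x∈ → x∈) (λ _ → pos-s) (_∈? I) ≤-refl N ame∈I N-fits
        (zs , (zs⊆I , zs≤1) , zs≡) , _ = opt
        xs , c , σ , 0≤σ , size≤ , profit≤ = structure zs zs⊆I zs≤1
        n , n≤σ , σ<1+n = divide σ (s aeff) 0≤σ pos-se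
    in conclude {xs} {o*} n (proj₂ (κ≥2 κ ε≤¼)) c opt (subst (_≤ o*) (sym P≡) P≤)
         (copies-fit {sizeL xs} {ℕ→ℚ n * s aeff} {sizeL zs} {σ} size≤ zs≤1 n≤σ)
         (round-small {xs} {σ} {o*} n c σ<1+n (subst (λ z → factor κ * z ≤ weight q c + ρ * σ) zs≡ profit≤))

theorem6 : (κ : ℕ) (I : List Item) (ame aeff : Item)
    (A At : ℕ → ℕ → Maybe Item) →
    ε κ ≤ ¼ →
    ((a : Item) → a ∈ I → (0ℚ < p a × p a ≤ 1ℚ) × (0ℚ < s a × s a ≤ 1ℚ)) →
    ame ∈ I →
    ((a : Item) → a ∈ I → p a * inv (s a) ≤ p ame * inv (s ame)) →
    ((a : Item) → a ∈ I → p a ≢ ℕ→ℚ 2 * P₀ ame) →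
    InIS κ I ame aeff →
    ((a : Item) → InIS κ I ame a → p a * inv (s a) ≤ p aeff * inv (s aeff)) →
    SpecA κ I ame A →
    SpecĨ κ ame A At →
    ((xs : List (Item ⊎ Item)) → QOptimal κ ame aeff A At xs →
    AtMostOne (FromĨ κ ame A At κ) xs) →
    Σ ℚ (λ v → (0ℚ ≤ v × v ≤ 1ℚ) ×
    Σ ℚ (λ o₁ → IsOPTS κ ame aeff A At v o₁ ×
    Σ ℚ (λ o₂ → IsOPT (1ℚ - v) (λ a → a ≡ aeff) o₂ ×
    ((o : ℚ) → IsOPT 1ℚ (λ a → a ∈ I) o →
    factor κ * o - Tᵖ κ ame ≤ o₁ + o₂))))
theorem6 κ I ame aeff A At ε≤¼ bounded ame∈I ame-best _ aeff∈IS aeff-best specA specĨ _ =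
  Instance.split-optimum κ I ame aeff A At ε≤¼ bounded ame∈I ame-best aeff∈IS aeff-best specA specĨ
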